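{- The sure reachability problem and the sure repeated reachability problem are decidable for 1-VASS-MDPs.
   Context: A VASS-MDP of dimension $d\ge 0$ is a tuple $S=\langle Q,Q_1,Q_P,T,\tau\rangle$ where $Q$ is a finite set of control states partitioned into $Q_1$ (Player 1) and $Q_P$ (probabilistic), $T\subseteq Q\times\mathbb{Z}^d\times Q$ is finite, and $\tau:T\to\mathbb{N}_{>0}$. Configurations are $\langle q,\mathbf{v}\rangle\in Q\times\mathbb{N}^d$; $t=\langle q,\mathbf{z},q'\rangle$ is enabled in $\langle q,\mathbf{v}\rangle$ if $\mathbf{v}+\mathbf{z}\in\mathbb{N}^d$ and leads to $\langle q',\mathbf{v}+\mathbf{z}\rangle$. The induced MDP $M_S=\langle C,C_1,C_P,\rightarrow,p\rangle$ has $C=Q\times\mathbb{N}^d$, $C_1=Q_1\times\mathbb{N}^d$, $C_P=Q_P\times\mathbb{N}^d$, $c\rightarrow c'$ iff $c'$ is obtained from $c$ by an enabled transition, and for $c\in C_P$, $p(c)(c')$ is the total weight of enabled transitions from $c$ leading to $c'$ divided by the total weight of transitions enabled in $c$. A configuration without successor is a deadlock. A 1-VASS-MDP is a VASS-MDP in which every transition $\langle q,\mathbf{z},q'\rangle$ with $q\in Q_P$ has $\mathbf{z}=\mathbf{0}$ (only Player 1 changes counters). A strategy $\sigma$ of Player 1 maps each finite play ending in a non-deadlock $c\in C_1$ to a successor of $c$; $\mathrm{Outcome}(M_S,c,\sigma)$ is the set of maximal plays (infinite or ending in a deadlock) from $c$ consistent with $\sigma$. For $q_F\in Q$, $[\![\Diamond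 q_F]\!]$ is the set of plays visiting control state $q_F$, and $[\![\Box\Diamond q_F]\!]$ the set of infinite plays visiting it infinitely often. The sure (resp. sure repeated) reachability problem asks, given $S$, an initial configuration $c_0$ and $q_F$, whether some $\sigma$ satisfies $\mathrm{Outcome}(M_S,c_0,\sigma)\subseteq[\![\Diamond q_F]\!]$ (resp. $\subseteq[\![\Box\Diamond q_F]\!]$). -}

module Defs where

open import Data.Nat using (ℕ; zero; suc; _<_; _≤_)
open import Data.Integer as ℤ using (ℤ; +_)
open import Data.Fin using (Fin; toℕ; inject₁; suc)
open import Data.Vec using (Vec; lookup; tabulate; last; replicate)
open import Data.List using (List; length)
open import Data.List.Membership.Propositional using (_∈_)
open import Data.List.Relation.Unary.Unique.Propositional using (Unique)
open import Data.Product using (Σ; ∃; _×_; proj₁)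
open import Relation.Binary.PropositionalEquality using (_≡_)
open import Relation.Nullary using (¬_)
open import Data.Empty using (⊥)

data Player : Set where
  player1 : Player
  prob    : Player

record Transition (d n : ℕ) : Set where
  constructor ⟨_,_,_⟩
  field
    src : Fin n
    vec : Vec ℤ d
    tgt : Fin n
open Transition public

record VASSMDP (d : ℕ) : Set where
  field
    nQ       : ℕ
    owner    : Fin nQ → Player
    trans    : List (Transition d nQ)
    unique   : Unique trans
    τ        : Fin (length trans) → ℕ
    τ-pos    : ∀ i → 0 < τ i
open VASSMDP public

OneVASS : ∀ {d} → VASSMDP d → Set
OneVASS {d} S = ∀ t → t ∈ trans S → owner S (src t) ≡ prob → vec t ≡ replicate d (+ 0)

module _ {d : ℕ} (S : VASSMDP d) where

  State : Set
  State = Fin (nQ S)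

  Conf : Set
  Conf = State × Vec ℕ d

  stateOf : Conf → State
  stateOf = proj₁

  Step : Conf → Conf → Set
  Step (q Data.Product., v) (q' Data.Product., v') =
    Σ (Transition d (nQ S)) λ t → t ∈ trans S × src t ≡ q × tgt t ≡ q' ×
      (∀ i → + lookup v' i ≡ (+ lookup v i) ℤ.+ lookup (vec t) i)

  Deadlock : Conf → Set
  Deadlock c = ¬ (∃ λ c' → Step c c')

  IsP1 : Conf → Set
  IsP1 c = owner S (stateOf c) ≡ player1

  IsPlay : ∀ {k} → Vec Conf (suc k) → Set
  IsPlay {k} cs = ∀ (i : Fin k) → Step (lookup cs (inject₁ i)) (lookup cs (suc i))

  Strategy : Set
  Strategy = ∀ {k} → Vec Conf (suc k) → Conf

  IsStrategy : Strategy → Set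
  IsStrategy σ = ∀ {k} (cs : Vec Conf (suc k)) → IsPlay cs →
    IsP1 (last cs) → ¬ Deadlock (last cs) → Step (last cs) (σ cs)

  prefix : (ℕ → Conf) → (i : ℕ) → Vec Conf (suc i)
  prefix ρ i = tabulate (λ j → ρ (toℕ j))

  StepOK : Strategy → (ℕ → Conf) → ℕ → Set
  StepOK σ ρ i = Step (ρ i) (ρ (suc i)) × (IsP1 (ρ i) → ρ (suc i) ≡ σ (prefix ρ i))

  InfOutcome : Conf → Strategy → (ℕ → Conf) → Set
  InfOutcome c₀ σ ρ = ρ 0 ≡ c₀ × (∀ i → StepOK σ ρ i)

  -- Finite maximal plays ρ(0) … ρ(k) in Outcome(M_S, c₀, σ) (ending in a
  -- deadlock); values of ρ beyond k are irrelevant.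
  FinOutcome : Conf → Strategy → (k : ℕ) → (ℕ → Conf) → Set
  FinOutcome c₀ σ k ρ = ρ 0 ≡ c₀ × (∀ i → i < k → StepOK σ ρ i) × Deadlock (ρ k)

  SureReach : Conf → State → Set
  SureReach c₀ qF = Σ Strategy λ σ → IsStrategy σ ×
    (∀ ρ → InfOutcome c₀ σ ρ → ∃ λ i → stateOf (ρ i) ≡ qF) ×
    (∀ k ρ → FinOutcome c₀ σ k ρ → ∃ λ i → i ≤ k × stateOf (ρ i) ≡ qF)

  SureRepReach : Conf → State → Set
  SureRepReach c₀ qF = Σ Strategy λ σ → IsStrategy σ ×
    (∀ ρ → InfOutcome c₀ σ ρ → ∀ m → ∃ λ i → m ≤ i × stateOf (ρ i) ≡ qF) ×
    (∀ k ρ → FinOutcome c₀ σ k ρ → ⊥)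

{-# OPTIONS --safe #-}

-- A 1-VASS-MDP is an energy game: Player 1 must keep all counters nonnegative,
-- and reachability is the Büchi condition after making the target absorbing.
-- The two players have explicit certificates, an invariant from which Player 1
-- can force a visit to F inside the invariant, and an inductive tree of sets in
-- which the opponent avoids F; it suffices to find one of them at each position.
--
-- If the initial credit is unknown, the opponent's choices at a state can be
-- separated: when Player 1 wins with each choice alone, she interleaves the two
-- plays. This leaves graphs without opponent, where winning amounts to reaching a
-- closed walk through F with nonnegative effect. The effects of walks form a
-- semilinear set (Kleene), so this is a question about cones of integer vectors
-- (double description); without such a walk, Dickson's lemma excludes infinitely
-- many visits to F. For given credit, Rackoff's induction on the set of tracked counters
-- applies: a tracked counter beyond a computable bound can be forgotten, and
-- below the bounds the tracked counters are part of a finite state.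

module Submission where

open import Defs
open import Data.Nat using (ℕ)
open import Data.Product using (_×_)
open import Relation.Nullary using (Dec)
open import Data.Bool as Bool using (Bool; true; false)
open import Data.Empty using (⊥; ⊥-elim)
open import Data.Fin using (Fin; zero; suc; toℕ; fromℕ<; inject₁)
import Data.Fin.Properties as Finₚ
open import Data.Fin.Subset as Subset using (Subset)
  renaming (_∈_ to _∈ˢ_; _∉_ to _∉ˢ_; _-_ to _⊖_)
open import Data.Fin.Subset.Properties
  using (_∈?_; x∈p∧x≢y⇒x∈p-y; p─q⊆p; x∈p⇒∣p-x∣<∣p∣; ∈⊤)
open import Data.Integer as ℤ using (ℤ; +_; -_; 0ℤ; 1ℤ; +≤+; +<+; ∣_∣)
import Data.Integer.Properties as ℤₚ
open import Data.Integer.Tactic.RingSolver using (solve-∀)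
open import Data.List as List
  using (List; []; _∷_; _++_; map; filter; length; allFin; cartesianProduct; cartesianProductWith)
open import Data.List.Membership.Propositional using (_∈_; find; lose)
open import Data.List.Membership.Propositional.Properties
  using (∈-map⁺; ∈-map⁻; ∈-++⁺ˡ; ∈-++⁺ʳ; ∈-++⁻; ∈-filter⁺; ∈-filter⁻; ∈-allFin;
         ∈-cartesianProductWith⁺; ∈-cartesianProductWith⁻; ∈-cartesianProduct⁺)
open import Data.List.Relation.Unary.Any as Any using (here; there; any?)
open import Data.List.Relation.Unary.Any.Properties using (lookup-index)
open import Data.Nat as ℕ using (zero; suc; z≤n; s≤s; _≤_; _<_; _∸_; _⊔_)
open import Data.Nat.Induction using (<-rec; <-wellFounded)
import Data.Nat.Properties as ℕₚ
open import Data.Product using (∃; _,_; proj₁; proj₂)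
import Data.Product.Properties as Productₚ
open import Data.Sum as Sum using (_⊎_; inj₁; inj₂; map₁; map₂; [_,_]′)
import Data.Sum.Properties as Sumₚ
open import Data.Unit using (⊤; tt)
open import Data.Vec using (Vec; []; _∷_; lookup; tabulate; last)
open import Data.Vec.Properties
  using (lookup∘tabulate; tabulate∘lookup; tabulate-cong; lookup-replicate; ≡-dec)
open import Data.Vec.Properties.WithK using ([]=-irrelevant)
open import Function using (_∘_; case_of_)
open import Induction.WellFounded using (Acc; acc)
open import Level using (Level; Lift; lift)
open import Relation.Binary.Definitions using (DecidableEquality; tri<; tri≈; tri>)
open import Relation.Binary.PropositionalEquality
  using (_≡_; _≢_; refl; sym; cong; cong₂; subst; subst₂) renaming (trans to ≡-trans)
open import Relation.Nullary using (¬_; yes; no; does; contradiction)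
open import Relation.Nullary.Decidable using (_×-dec_; dec-true)

-- Cones of integer vectors

-- Splitting the opponent's choices relies on credits being additive: if each choice can be won with
-- some credit, the sum of the two credits pays for both plays at once. If a choice loses with every
-- credit, the opponent can commit to it, and the vertex may be replaced by a dead end. For a given
-- credit the sum may be unaffordable, so the result on unknown credit serves as a subroutine there:
-- on each finite arena it supplies credits, and their maximum enters the next bound.
--
-- Determinacy has to be computed, so a loss is a positive object and not the absence of a winning
-- invariant. It is turned against a given strategy of Player 1 by producing a single play that
-- refutes that strategy. Certificates are positional while strategies see the whole past, so the
-- refutation covers all histories that end in a position.
--
-- The 1-VASS condition is what makes the MDP an energy game: probabilistic transitions do not
-- change the counters, hence are never disabled, which matches the rule that the opponent's moves
-- are never blocked.

ℤVec : ℕ → Set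
ℤVec d = Fin d → ℤ

0<* : ∀ {a b} → 0ℤ ℤ.< a → 0ℤ ℤ.< b → 0ℤ ℤ.< a ℤ.* b
0<* (+<+ {n = suc m} _) (+<+ {n = suc n} _) = +<+ (s≤s z≤n)

0≤* : ∀ {a b} → 0ℤ ℤ.≤ a → 0ℤ ℤ.≤ b → 0ℤ ℤ.≤ a ℤ.* b
0≤* {+ m} {+ n} _ _ = subst (0ℤ ℤ.≤_) (ℤₚ.pos-* m n) (+≤+ z≤n)

0≤+ : ∀ {a b} → 0ℤ ℤ.≤ a → 0ℤ ℤ.≤ b → 0ℤ ℤ.≤ a ℤ.+ b
0≤+ = ℤₚ.+-mono-≤

0<-neg : ∀ {a} → a ℤ.< 0ℤ → 0ℤ ℤ.< - a
0<-neg = ℤₚ.neg-mono-<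

*≤0⇒≤0 : ∀ {k a} → 0ℤ ℤ.< k → k ℤ.* a ℤ.≤ 0ℤ → a ℤ.≤ 0ℤ
*≤0⇒≤0 {k} {a} 0<k ka≤0 with a ℤ.≤? 0ℤ
... | yes a≤0 = a≤0
... | no a≰0 = ⊥-elim (ℤₚ.<⇒≱ (0<* 0<k (ℤₚ.≰⇒> a≰0)) ka≤0)

-- Coefficients are natural numbers, so this is a monoid. The rational cone is recovered by allowing
-- a positive factor on the element, the `k` of the statements below.
data Cone {d} (G : List (ℤVec d)) (x : ℤVec d) : Set where
  nil  : (∀ i → x i ≡ 0ℤ) → Cone G x
  cons : ∀ {g y} → g ∈ G → Cone G y → (∀ i → x i ≡ g i ℤ.+ y i) → Cone G x

module _ {d : ℕ} where

  private variable
    G H : List (ℤVec d)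
    x y : ℤVec d

  cone-resp : Cone G x → (∀ i → y i ≡ x i) → Cone G y
  cone-resp (nil e) eq = nil λ i → ≡-trans (eq i) (e i)
  cone-resp (cons g∈G c e) eq = cons g∈G c λ i → ≡-trans (eq i) (e i)

  cone-+ : Cone G x → Cone G y → Cone G (λ i → x i ℤ.+ y i)
  cone-+ {y = y} (nil e) c′ =
    cone-resp c′ λ i → ≡-trans (cong (ℤ._+ y i) (e i)) (ℤₚ.+-identityˡ (y i))
  cone-+ {y = y} (cons {g} {z} g∈G c e) c′ = cons g∈G (cone-+ c c′) λ i →
    ≡-trans (cong (ℤ._+ y i) (e i)) (ℤₚ.+-assoc (g i) (z i) (y i))

  cone-bind : (∀ {g} → g ∈ G → Cone H g) → Cone G x → Cone H x
  cone-bind f (nil e) = nil e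
  cone-bind f (cons g∈G c e) = cone-resp (cone-+ (f g∈G) (cone-bind f c)) e

  cone-gen : ∀ {g} → g ∈ G → Cone G g
  cone-gen g∈G = cons g∈G (nil λ _ → refl) λ i → sym (ℤₚ.+-identityʳ _)

  cone-mono : (∀ {g} → g ∈ G → g ∈ H) → Cone G x → Cone H x
  cone-mono f = cone-bind (cone-gen ∘ f)

  cone-scaleℕ : ∀ n → Cone G x → Cone G (λ i → + n ℤ.* x i)
  cone-scaleℕ zero c = nil λ i → refl
  cone-scaleℕ {x = x} (suc n) c =
    cone-resp (cone-+ c (cone-scaleℕ n c)) λ i → ℤₚ.suc-* (+ n) (x i)

  cone-scale : ∀ {k} → 0ℤ ℤ.≤ k → Cone G x → Cone G (λ i → k ℤ.* x i)
  cone-scale {k = + n} _ = cone-scaleℕ n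

  cone-split : ∀ G → Cone (G ++ H) x →
    ∃ λ y → ∃ λ z → Cone G y × Cone H z × (∀ i → x i ≡ y i ℤ.+ z i)
  cone-split G (nil e) = (λ _ → 0ℤ) , (λ _ → 0ℤ) , nil (λ _ → refl) , nil (λ _ → refl) , e
  cone-split G (cons {g} g∈ c e) with cone-split G c | ∈-++⁻ G g∈
  ... | y , z , cy , cz , e′ | inj₁ g∈G =
        _ , z , cone-+ (cone-gen g∈G) cy , cz ,
        λ i → ≡-trans (e i) (≡-trans (cong (ℤ._+_ (g i)) (e′ i)) (sym (ℤₚ.+-assoc (g i) (y i) (z i))))
  ... | y , z , cy , cz , e′ | inj₂ g∈H =
        y , _ , cy , cone-+ (cone-gen g∈H) cz ,
        λ i → ≡-trans (e i) (≡-trans (cong (ℤ._+_ (g i)) (e′ i)) (swap (g i) (y i) (z i)))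
    where
    swap : ∀ a b c → a ℤ.+ (b ℤ.+ c) ≡ b ℤ.+ (a ℤ.+ c)
    swap = solve-∀

  cone-≥0 : ∀ j → (∀ {g} → g ∈ G → 0ℤ ℤ.≤ g j) → Cone G x → 0ℤ ℤ.≤ x j
  cone-≥0 j p (nil e) = ℤₚ.≤-reflexive (sym (e j))
  cone-≥0 j p (cons g∈ c e) = subst (0ℤ ℤ.≤_) (sym (e j)) (0≤+ (p g∈) (cone-≥0 j p c))

  cone-≤0 : ∀ j → (∀ {g} → g ∈ G → g j ℤ.≤ 0ℤ) → Cone G x → x j ℤ.≤ 0ℤ
  cone-≤0 j p (nil e) = ℤₚ.≤-reflexive (e j)
  cone-≤0 j p (cons g∈ c e) =
    subst (ℤ._≤ 0ℤ) (sym (e j)) (ℤₚ.+-mono-≤ (p g∈) (cone-≤0 j p c))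

  -- One step of the double description method: the part of the cone of G
  -- where coordinate j is nonnegative is generated, up to scaling, by the
  -- generators that are nonnegative at j and by the combinations of a positive
  -- and a negative generator that cancel at j.
  module Eliminate (j : Fin d) (G : List (ℤVec d)) where

    G⁺ G⁻ G⁰ G′ : List (ℤVec d)

    cancel : ℤVec d → ℤVec d → ℤVec d
    cancel g h i = g j ℤ.* h i ℤ.- h j ℤ.* g i

    G⁺ = filter (λ g → 0ℤ ℤ.<? g j) G
    G⁻ = filter (λ g → g j ℤ.<? 0ℤ) G
    G⁰ = filter (λ g → g j ℤ.≟ 0ℤ) G ++ cartesianProductWith cancel G⁺ G⁻
    G′ = G⁰ ++ G⁺

    cancel-cone₁ : ∀ {g} → g ∈ G⁺ → Cone G⁻ x → Cone G⁰ (cancel g x)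
    cancel-cone₁ {g = g} g∈ (nil e) = nil λ i →
      ≡-trans (cong₂ (λ a b → g j ℤ.* a ℤ.- b ℤ.* g i) (e i) (e j)) (lem (g j) (g i))
      where
      lem : ∀ a b → a ℤ.* 0ℤ ℤ.- 0ℤ ℤ.* b ≡ 0ℤ
      lem = solve-∀
    cancel-cone₁ {g = g} g∈ (cons {h} {y} h∈ c e) =
      cons (∈-++⁺ʳ (filter (λ g → g j ℤ.≟ 0ℤ) G) (∈-cartesianProductWith⁺ cancel g∈ h∈))
        (cancel-cone₁ g∈ c)
        λ i → ≡-trans (cong₂ (λ a b → g j ℤ.* a ℤ.- b ℤ.* g i) (e i) (e j))
                (lem (g j) (g i) (h i) (y i) (h j) (y j))
      where
      lem : ∀ a b hi yi hj yj → a ℤ.* (hi ℤ.+ yi) ℤ.- (hj ℤ.+ yj) ℤ.* b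
            ≡ (a ℤ.* hi ℤ.- hj ℤ.* b) ℤ.+ (a ℤ.* yi ℤ.- yj ℤ.* b)
      lem = solve-∀

    cancel-cone : Cone G⁺ x → Cone G⁻ y → Cone G⁰ (cancel x y)
    cancel-cone {y = y} (nil e) c′ = nil λ i →
      ≡-trans (cong₂ (λ a b → a ℤ.* y i ℤ.- y j ℤ.* b) (e j) (e i)) (lem (y i) (y j))
      where
      lem : ∀ a b → 0ℤ ℤ.* a ℤ.- b ℤ.* 0ℤ ≡ 0ℤ
      lem = solve-∀
    cancel-cone {y = y} (cons {g} {z} g∈ c e) c′ =
      cone-resp (cone-+ (cancel-cone₁ g∈ c′) (cancel-cone c c′)) λ i →
        ≡-trans (cong₂ (λ a b → a ℤ.* y i ℤ.- y j ℤ.* b) (e j) (e i))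
          (lem (g j) (g i) (z j) (z i) (y i) (y j))
      where
      lem : ∀ gj gi zj zi a b → (gj ℤ.+ zj) ℤ.* a ℤ.- b ℤ.* (gi ℤ.+ zi)
            ≡ (gj ℤ.* a ℤ.- b ℤ.* gi) ℤ.+ (zj ℤ.* a ℤ.- b ℤ.* zi)
      lem = solve-∀

    pos⇒≥0 : Cone G⁺ x → 0ℤ ℤ.≤ x j
    pos⇒≥0 = cone-≥0 j λ g∈ → ℤₚ.<⇒≤ (proj₂ (∈-filter⁻ (λ g → 0ℤ ℤ.<? g j) {xs = G} g∈))

    neg⇒≤0 : Cone G⁻ x → x j ℤ.≤ 0ℤ
    neg⇒≤0 = cone-≤0 j λ g∈ → ℤₚ.<⇒≤ (proj₂ (∈-filter⁻ (λ g → g j ℤ.<? 0ℤ) {xs = G} g∈))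

    neg-≥0⇒≡0 : Cone G⁻ x → 0ℤ ℤ.≤ x j → ∀ i → x i ≡ 0ℤ
    neg-≥0⇒≡0 (nil e) _ = e
    neg-≥0⇒≡0 (cons g∈ c e) 0≤x = ⊥-elim (ℤₚ.<⇒≱
      (subst (ℤ._< 0ℤ) (sym (e j))
        (ℤₚ.+-mono-<-≤ (proj₂ (∈-filter⁻ (λ g → g j ℤ.<? 0ℤ) {xs = G} g∈)) (neg⇒≤0 c)))
      0≤x)

    Balanced : ℤVec d → Set
    Balanced x = ∃ λ k → ∃ λ y → ∃ λ z → 0ℤ ℤ.< k × Cone G⁰ y × (Cone G⁺ z ⊎ Cone G⁻ z) ×
      (∀ i → k ℤ.* x i ≡ y i ℤ.+ z i)

    -- If `x j` is at least `- y j`, the identity x_j (x + y) = (x_j y - y_j x) + (x_j + y_j) x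
    -- leaves only a nonnegative multiple of `x` besides cancelled combinations; the other case is
    -- symmetric. The last hypothesis makes the factor strictly positive.
    merge : Cone G⁺ x → Cone G⁻ y → 0ℤ ℤ.< x j ⊎ y j ℤ.< 0ℤ → Balanced (λ i → x i ℤ.+ y i)
    merge {x} {y} cx cy nz with ℤₚ.≤-total (- y j) (x j)
    ... | inj₁ -y≤x =
          x j , _ , _ , 0<x nz , cancel-cone cx cy ,
          inj₁ (cone-scale (ℤₚ.i≤j⇒0≤j-i -y≤x) cx) , λ i → lem (x j) (y j) (x i) (y i)
      where
      0<x : 0ℤ ℤ.< x j ⊎ y j ℤ.< 0ℤ → 0ℤ ℤ.< x j
      0<x (inj₁ p) = p
      0<x (inj₂ p) = ℤₚ.<-≤-trans (0<-neg p) -y≤x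
      lem : ∀ xj yj xi yi → xj ℤ.* (xi ℤ.+ yi)
            ≡ (xj ℤ.* yi ℤ.- yj ℤ.* xi) ℤ.+ (xj ℤ.- (- yj)) ℤ.* xi
      lem = solve-∀
    ... | inj₂ x≤-y =
          - y j , _ , _ , 0<-y nz , cancel-cone cx cy ,
          inj₂ (cone-scale (ℤₚ.i≤j⇒0≤j-i x≤-y) cy) , λ i → lem (x j) (y j) (x i) (y i)
      where
      0<-y : 0ℤ ℤ.< x j ⊎ y j ℤ.< 0ℤ → 0ℤ ℤ.< - y j
      0<-y (inj₁ p) = ℤₚ.<-≤-trans p x≤-y
      0<-y (inj₂ p) = 0<-neg p
      lem : ∀ xj yj xi yi → (- yj) ℤ.* (xi ℤ.+ yi)
            ≡ (xj ℤ.* yi ℤ.- yj ℤ.* xi) ℤ.+ ((- yj) ℤ.- xj) ℤ.* yi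
      lem = solve-∀

    absorb : ∀ {k u w} → 0ℤ ℤ.< k → Cone G⁰ u → (∀ i → k ℤ.* x i ≡ u i ℤ.+ w i) →
             Balanced w → Balanced x
    absorb {x = x} {k} {u} {w} 0<k cu e (k′ , y , z , 0<k′ , cy , cz , e′) =
      k′ ℤ.* k , _ , z , 0<* 0<k′ 0<k , cone-+ (cone-scale (ℤₚ.<⇒≤ 0<k′) cu) cy , cz , eq
      where
      lem : ∀ k′ u y z → (k′ ℤ.* u) ℤ.+ (y ℤ.+ z) ≡ ((k′ ℤ.* u) ℤ.+ y) ℤ.+ z
      lem = solve-∀
      eq : ∀ i → (k′ ℤ.* k) ℤ.* x i ≡ ((k′ ℤ.* u i) ℤ.+ y i) ℤ.+ z i
      eq i = ≡-trans (ℤₚ.*-assoc k′ k (x i)) (≡-trans (cong (k′ ℤ.*_) (e i))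
        (≡-trans (ℤₚ.*-distribˡ-+ k′ (u i) (w i)) (≡-trans (cong (ℤ._+_ (k′ ℤ.* u i)) (e′ i))
          (lem k′ (u i) (y i) (z i)))))

    balanced-one : Cone G⁺ x ⊎ Cone G⁻ x → Balanced x
    balanced-one {x} c = 1ℤ , (λ _ → 0ℤ) , x , +<+ (s≤s z≤n) , nil (λ _ → refl) , c , λ i → lem (x i)
      where
      lem : ∀ a → 1ℤ ℤ.* a ≡ 0ℤ ℤ.+ a
      lem = solve-∀

    balance : Cone G x → Balanced x
    balance (nil e) = 1ℤ , (λ _ → 0ℤ) , (λ _ → 0ℤ) , +<+ (s≤s z≤n) , nil (λ _ → refl) ,
      inj₁ (nil λ _ → refl) , λ i → cong (1ℤ ℤ.*_) (e i)
    balance {x} (cons {g} {x′} g∈ c e) with balance c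
    ... | k , y , z , 0<k , cy , cz , e′ = add (ℤₚ.<-cmp (g j) 0ℤ) cz
      where
      eq : ∀ i → k ℤ.* x i ≡ y i ℤ.+ (k ℤ.* g i ℤ.+ z i)
      eq i = ≡-trans (cong (k ℤ.*_) (e i)) (≡-trans (ℤₚ.*-distribˡ-+ k (g i) (x′ i))
        (≡-trans (cong (ℤ._+_ (k ℤ.* g i)) (e′ i)) (lem (k ℤ.* g i) (y i) (z i))))
        where
        lem : ∀ a b c → a ℤ.+ (b ℤ.+ c) ≡ b ℤ.+ (a ℤ.+ c)
        lem = solve-∀
      eq′ : ∀ i → k ℤ.* x i ≡ y i ℤ.+ (z i ℤ.+ k ℤ.* g i)
      eq′ i = ≡-trans (eq i) (cong (ℤ._+_ (y i)) (ℤₚ.+-comm (k ℤ.* g i) (z i)))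
      kg : ∀ {H} → g ∈ H → Cone H (λ i → k ℤ.* g i)
      kg g∈H = cone-scale (ℤₚ.<⇒≤ 0<k) (cone-gen g∈H)
      add : _ → Cone G⁺ z ⊎ Cone G⁻ z → Balanced x
      add (tri≈ _ g≡0 _) cz =
        absorb 0<k (cone-+ cy (kg (∈-++⁺ˡ (∈-filter⁺ (λ g → g j ℤ.≟ 0ℤ) g∈ g≡0))))
          (λ i → ≡-trans (eq i) (sym (ℤₚ.+-assoc (y i) (k ℤ.* g i) (z i)))) (balanced-one cz)
      add (tri> _ _ 0<g) (inj₁ cz) =
        absorb 0<k cy eq (balanced-one
          (inj₁ (cone-+ (kg (∈-filter⁺ (λ g → 0ℤ ℤ.<? g j) g∈ 0<g)) cz)))
      add (tri> _ _ 0<g) (inj₂ cz) =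
        absorb 0<k cy eq
          (merge (kg (∈-filter⁺ (λ g → 0ℤ ℤ.<? g j) g∈ 0<g)) cz (inj₁ (0<* 0<k 0<g)))
      add (tri< g<0 _ _) (inj₂ cz) =
        absorb 0<k cy eq (balanced-one
          (inj₂ (cone-+ (kg (∈-filter⁺ (λ g → g j ℤ.<? 0ℤ) g∈ g<0)) cz)))
      add (tri< g<0 _ _) (inj₁ cz) =
        absorb 0<k cy eq′
          (merge cz (kg (∈-filter⁺ (λ g → g j ℤ.<? 0ℤ) g∈ g<0))
            (inj₂ (ℤₚ.neg-cancel-< (subst (0ℤ ℤ.<_) (lem k (g j)) (0<* 0<k (0<-neg g<0))))))
        where
        lem : ∀ a b → a ℤ.* (- b) ≡ - (a ℤ.* b)
        lem = solve-∀

    cancel≡0 : ∀ g h → cancel g h j ≡ 0ℤ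
    cancel≡0 g h = lem (g j) (h j)
      where
      lem : ∀ a b → a ℤ.* b ℤ.- b ℤ.* a ≡ 0ℤ
      lem = solve-∀

    G⁰-zero : ∀ {g} → g ∈ G⁰ → g j ≡ 0ℤ
    G⁰-zero g∈ with ∈-++⁻ (filter (λ g → g j ℤ.≟ 0ℤ) G) g∈
    ... | inj₁ q = proj₂ (∈-filter⁻ (λ g → g j ℤ.≟ 0ℤ) {xs = G} q)
    ... | inj₂ q with ∈-cartesianProductWith⁻ cancel G⁺ G⁻ q
    ...   | g , h , _ , _ , refl = cancel≡0 g h

    G′-≥0 : ∀ {g} → g ∈ G′ → 0ℤ ℤ.≤ g j
    G′-≥0 g∈ with ∈-++⁻ G⁰ g∈
    ... | inj₁ q = ℤₚ.≤-reflexive (sym (G⁰-zero q))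
    ... | inj₂ q = pos⇒≥0 (cone-gen q)

    G′⊆cone : ∀ {g} → g ∈ G′ → Cone G g
    G′⊆cone g∈ with ∈-++⁻ G⁰ g∈
    ... | inj₂ q = cone-gen (proj₁ (∈-filter⁻ (λ g → 0ℤ ℤ.<? g j) q))
    ... | inj₁ q with ∈-++⁻ (filter (λ g → g j ℤ.≟ 0ℤ) G) q
    ...   | inj₁ r = cone-gen (proj₁ (∈-filter⁻ (λ g → g j ℤ.≟ 0ℤ) r))
    ...   | inj₂ r with ∈-cartesianProductWith⁻ cancel G⁺ G⁻ r
    ...     | g , h , g∈ , h∈ , refl =
              cone-resp (cone-+ (cone-scale (ℤₚ.<⇒≤ 0<g) (cone-gen h∈G))
                                (cone-scale (ℤₚ.<⇒≤ (0<-neg h<0)) (cone-gen g∈G)))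
                λ i → lem (g j) (h j) (g i) (h i)
      where
      g∈G = proj₁ (∈-filter⁻ (λ g → 0ℤ ℤ.<? g j) {xs = G} g∈)
      0<g = proj₂ (∈-filter⁻ (λ g → 0ℤ ℤ.<? g j) {xs = G} g∈)
      h∈G = proj₁ (∈-filter⁻ (λ g → g j ℤ.<? 0ℤ) {xs = G} h∈)
      h<0 = proj₂ (∈-filter⁻ (λ g → g j ℤ.<? 0ℤ) {xs = G} h∈)
      lem : ∀ gj hj gi hi → gj ℤ.* hi ℤ.- hj ℤ.* gi ≡ gj ℤ.* hi ℤ.+ (- hj) ℤ.* gi
      lem = solve-∀

    -- A remainder of negative generators must vanish: the part from `G⁰` contributes nothing at
    -- `j`, so any negative generator would make coordinate `j` negative.
    eliminate-complete : Cone G x → 0ℤ ℤ.≤ x j →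
      ∃ λ k → 0ℤ ℤ.< k × Cone G′ (λ i → k ℤ.* x i)
    eliminate-complete {x} c 0≤x with balance c
    ... | k , y , z , 0<k , cy , inj₁ cz , e =
          k , 0<k , cone-resp (cone-+ (cone-mono ∈-++⁺ˡ cy) (cone-mono (∈-++⁺ʳ G⁰) cz)) e
    ... | k , y , z , 0<k , cy , inj₂ cz , e =
          k , 0<k , cone-resp (cone-mono ∈-++⁺ˡ cy) λ i →
            ≡-trans (e i) (≡-trans (cong (ℤ._+_ (y i)) (z≡0 i)) (ℤₚ.+-identityʳ (y i)))
      where
      y≤0 : y j ℤ.≤ 0ℤ
      y≤0 = cone-≤0 j (λ g∈ → ℤₚ.≤-reflexive (G⁰-zero g∈)) cy
      kx≤z : k ℤ.* x j ℤ.≤ z j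
      kx≤z = subst₂ ℤ._≤_ (sym (e j)) (ℤₚ.+-identityˡ (z j)) (ℤₚ.+-monoˡ-≤ (z j) y≤0)
      z≡0 = neg-≥0⇒≡0 cz (ℤₚ.≤-trans (0≤* (ℤₚ.<⇒≤ 0<k) 0≤x) kx≤z)

  module _ (m : Fin d) where

    -- Each elimination turns the constraint at `j` into a property of the generators; with no
    -- constraint left, only the signs of the generators at `m` matter. The conditions are
    -- homogeneous, so the scaling factors do no harm.
    nonnegative-in-cone : (js : List (Fin d)) (G : List (ℤVec d)) →
      (∃ λ x → Cone G x × (∀ j → j ∈ js → 0ℤ ℤ.≤ x j) × 0ℤ ℤ.< x m) ⊎
      (∀ x → Cone G x → (∀ j → j ∈ js → 0ℤ ℤ.≤ x j) → x m ℤ.≤ 0ℤ)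
    nonnegative-in-cone [] G with any? (λ g → 0ℤ ℤ.<? g m) G
    ... | yes p = let (g , g∈ , 0<g) = find p in inj₁ (g , cone-gen g∈ , (λ _ ()) , 0<g)
    ... | no ¬p = inj₂ λ x c _ → cone-≤0 m (λ g∈ → ℤₚ.≮⇒≥ λ 0<g → ¬p (lose g∈ 0<g)) c
    nonnegative-in-cone (j ∷ js) G with nonnegative-in-cone js (Eliminate.G′ j G)
    ... | inj₁ (x , c , 0≤x , 0<x) = inj₁ (x , cone-bind E.G′⊆cone c , nonneg , 0<x)
      where
      module E = Eliminate j G
      nonneg : ∀ i → i ∈ j ∷ js → 0ℤ ℤ.≤ x i
      nonneg i (here refl) = cone-≥0 j E.G′-≥0 c
      nonneg i (there i∈) = 0≤x i i∈
    ... | inj₂ none = inj₂ λ x c 0≤x →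
          let (k , 0<k , ck) = Eliminate.eliminate-complete j G c (0≤x j (here refl)) in
          *≤0⇒≤0 0<k (none _ ck λ i i∈ → 0≤* (ℤₚ.<⇒≤ 0<k) (0≤x i (there i∈)))

module _ {d : ℕ} where

  -- Prepending a coordinate that counts the uses of b turns "b occurs" into
  -- positivity of coordinate zero.
  mark : ℤ → ℤVec d → ℤVec (suc d)
  mark c x zero = c
  mark c x (suc i) = x i

  unmark : ∀ {b} {P : List (ℤVec d)} {x} → Cone (mark 1ℤ b ∷ map (mark 0ℤ) P) x →
    ∃ λ n → ∃ λ c → x zero ≡ + n × Cone P c × (∀ i → x (suc i) ≡ + n ℤ.* b i ℤ.+ c i)
  unmark (nil e) = 0 , (λ _ → 0ℤ) , e zero , nil (λ _ → refl) , λ i → e (suc i)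
  unmark {b} (cons (here refl) cy e) with unmark cy
  ... | n , c , e₀ , cc , e₁ = suc n , c , ≡-trans (e zero) (cong (ℤ._+_ 1ℤ) e₀) , cc , λ i →
        ≡-trans (e (suc i)) (≡-trans (cong (ℤ._+_ (b i)) (e₁ i))
          (≡-trans (sym (ℤₚ.+-assoc (b i) (+ n ℤ.* b i) (c i)))
                 (cong (ℤ._+ c i) (sym (ℤₚ.suc-* (+ n) (b i))))))
  unmark {b} (cons (there g∈) cy e) with unmark cy | ∈-map⁻ (mark 0ℤ) g∈
  ... | n , c , e₀ , cc , e₁ | p , p∈ , refl =
        n , _ , ≡-trans (e zero) (≡-trans (ℤₚ.+-identityˡ _) e₀) , cone-+ (cone-gen p∈) cc , λ i →
        ≡-trans (e (suc i)) (≡-trans (cong (ℤ._+_ (p i)) (e₁ i)) (lem (p i) (+ n ℤ.* b i) (c i)))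
    where
    lem : ∀ a b c → a ℤ.+ (b ℤ.+ c) ≡ b ℤ.+ (a ℤ.+ c)
    lem = solve-∀

  marked : ∀ {b} {P : List (ℤVec d)} {c} → Cone P c → Cone (mark 1ℤ b ∷ map (mark 0ℤ) P) (mark 0ℤ c)
  marked (nil e) = nil λ { zero → refl ; (suc i) → e i }
  marked (cons g∈ c e) =
    cons (there (∈-map⁺ (mark 0ℤ) g∈)) (marked c) λ { zero → refl ; (suc i) → e i }

  -- The first alternative may use `b` several times and so leave the linear set. This is the price
  -- of scaling, and closed walks can pay it by repetition.
  nonnegative-linear : (b : ℤVec d) (P : List (ℤVec d)) →
    (∃ λ n → ∃ λ c → Cone P c × (∀ i → 0ℤ ℤ.≤ + suc n ℤ.* b i ℤ.+ c i)) ⊎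
    (∀ c → Cone P c → ¬ (∀ i → 0ℤ ℤ.≤ b i ℤ.+ c i))
  nonnegative-linear b P
    with nonnegative-in-cone zero (map suc (allFin d)) (mark 1ℤ b ∷ map (mark 0ℤ) P)
  ... | inj₁ (x , cx , 0≤x , 0<x) with unmark cx
  ...   | zero , c , e₀ , _ = ⊥-elim (ℤₚ.<-irrefl (sym e₀) 0<x)
  ...   | suc n , c , _ , cc , e = inj₁ (n , c , cc , λ i →
          subst (0ℤ ℤ.≤_) (e i) (0≤x (suc i) (∈-map⁺ suc (∈-allFin i))))
  nonnegative-linear b P | inj₂ none = inj₂ λ c cc 0≤ →
    ℤₚ.<⇒≱ (+<+ (s≤s z≤n)) (none (mark 1ℤ (λ i → b i ℤ.+ c i))
      (cons (here refl) (marked cc) λ { zero → refl ; (suc i) → refl })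
      λ j j∈ → pos {c} 0≤ (∈-map⁻ suc j∈))
    where
    pos : ∀ {c j} → (∀ i → 0ℤ ℤ.≤ b i ℤ.+ c i) → (∃ λ i → i ∈ allFin d × j ≡ suc i) →
          0ℤ ℤ.≤ mark 1ℤ (λ i → b i ℤ.+ c i) j
    pos 0≤ (i , _ , refl) = 0≤ i

-- Effects of walks

module Linear {d : ℕ} where

  LinearSet : Set
  LinearSet = ℤVec d × List (ℤVec d)

  _∈ₗ_ : ℤVec d → LinearSet → Set
  x ∈ₗ (b , P) = ∃ λ c → Cone P c × (∀ i → x i ≡ b i ℤ.+ c i)

  _∈ₛ_ : ℤVec d → List LinearSet → Set
  x ∈ₛ Ls = ∃ λ L → L ∈ Ls × x ∈ₗ L

  _⊕_ : LinearSet → LinearSet → LinearSet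
  (b , P) ⊕ (b′ , P′) = (λ i → b i ℤ.+ b′ i) , P ++ P′

  _⊗_ : List LinearSet → List LinearSet → List LinearSet
  _⊗_ = cartesianProductWith _⊕_

  -- (b + ⟨P⟩)* = {0} ∪ (b + ⟨b , P⟩), and by commutativity the star of a union
  -- is the sum of the stars.
  star : List LinearSet → List LinearSet
  star [] = ((λ _ → 0ℤ) , []) ∷ []
  star ((b , P) ∷ Ls) = star Ls ++ map ((b , b ∷ P) ⊕_) (star Ls)

  ∈ₛ-++ˡ : ∀ {x Ls Ms} → x ∈ₛ Ls → x ∈ₛ (Ls ++ Ms)
  ∈ₛ-++ˡ (L , L∈ , p) = L , ∈-++⁺ˡ L∈ , p

  ∈ₛ-++ʳ : ∀ {x Ms} Ls → x ∈ₛ Ms → x ∈ₛ (Ls ++ Ms)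
  ∈ₛ-++ʳ Ls (L , L∈ , p) = L , ∈-++⁺ʳ Ls L∈ , p

  interchange : ∀ a b c d → (a ℤ.+ b) ℤ.+ (c ℤ.+ d) ≡ (a ℤ.+ c) ℤ.+ (b ℤ.+ d)
  interchange = solve-∀

  ∈ₗ-⊕ : ∀ {x y z} L M → x ∈ₗ L → y ∈ₗ M → (∀ i → z i ≡ x i ℤ.+ y i) → z ∈ₗ (L ⊕ M)
  ∈ₗ-⊕ (b , P) (b′ , P′) (c , cc , e) (c′ , cc′ , e′) eq =
    _ , cone-+ (cone-mono ∈-++⁺ˡ cc) (cone-mono (∈-++⁺ʳ P) cc′) ,
    λ i → ≡-trans (eq i) (≡-trans (cong₂ ℤ._+_ (e i) (e′ i)) (interchange (b i) (c i) (b′ i) (c′ i)))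

  ∈ₛ-⊗ : ∀ {x y z Ls Ms} → x ∈ₛ Ls → y ∈ₛ Ms → (∀ i → z i ≡ x i ℤ.+ y i) → z ∈ₛ (Ls ⊗ Ms)
  ∈ₛ-⊗ (L , L∈ , p) (M , M∈ , q) eq =
    L ⊕ M , ∈-cartesianProductWith⁺ _⊕_ L∈ M∈ , ∈ₗ-⊕ L M p q eq

  ⊕-split : ∀ {x} L M → x ∈ₗ (L ⊕ M) →
    ∃ λ y → ∃ λ z → y ∈ₗ L × z ∈ₗ M × (∀ i → x i ≡ y i ℤ.+ z i)
  ⊕-split (b , P) (b′ , P′) (c , cc , e) with cone-split P cc
  ... | y , z , cy , cz , e′ = _ , _ , (y , cy , λ _ → refl) , (z , cz , λ _ → refl) ,
        λ i → ≡-trans (e i) (≡-trans (cong (ℤ._+_ (b i ℤ.+ b′ i)) (e′ i))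
          (interchange (b i) (b′ i) (y i) (z i)))

  ⊗-split : ∀ {x} Ls Ms → x ∈ₛ (Ls ⊗ Ms) →
    ∃ λ y → ∃ λ z → y ∈ₛ Ls × z ∈ₛ Ms × (∀ i → x i ≡ y i ℤ.+ z i)
  ⊗-split Ls Ms (_ , L∈ , p) with ∈-cartesianProductWith⁻ _⊕_ Ls Ms L∈
  ... | L , M , L∈ , M∈ , refl with ⊕-split L M p
  ...   | y , z , py , pz , e = y , z , (L , L∈ , py) , (M , M∈ , pz) , e

  star-zero : ∀ {x} Ls → (∀ i → x i ≡ 0ℤ) → x ∈ₛ star Ls
  star-zero [] e = _ , here refl , (λ _ → 0ℤ) , nil (λ _ → refl) , e
  star-zero (_ ∷ Ls) e = ∈ₛ-++ˡ (star-zero Ls e)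

  star-snoc : ∀ {x y z} Ls → x ∈ₛ star Ls → y ∈ₛ Ls → (∀ i → z i ≡ x i ℤ.+ y i) → z ∈ₛ star Ls
  star-snoc {x} {y} {z} ((b , P) ∷ Ls) (L , L∈ , p) (M , M∈ , q) eq with ∈-++⁻ (star Ls) L∈ | M∈
  ... | inj₁ L∈ | there M∈ = ∈ₛ-++ˡ (star-snoc Ls (L , L∈ , p) (M , M∈ , q) eq)
  ... | inj₁ L∈ | here refl =
        ∈ₛ-++ʳ (star Ls) (_ , ∈-map⁺ ((b , b ∷ P) ⊕_) L∈ ,
          ∈ₗ-⊕ (b , b ∷ P) L (weaken q) p λ i → ≡-trans (eq i) (ℤₚ.+-comm (x i) (y i)))
    where
    weaken : ∀ {y} → y ∈ₗ (b , P) → y ∈ₗ (b , b ∷ P)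
    weaken (c , cc , e) = c , cone-mono there cc , e
  ... | inj₂ L∈ | M∈ with ∈-map⁻ ((b , b ∷ P) ⊕_) L∈
  ...   | L′ , L′∈ , refl with ⊕-split (b , b ∷ P) L′ p | M∈
  ...     | u , v , pu , pv , e | there M∈
          with star-snoc {z = λ i → v i ℤ.+ y i} Ls (L′ , L′∈ , pv) (M , M∈ , q) (λ _ → refl)
  ...       | L″ , L″∈ , pw =
              ∈ₛ-++ʳ (star Ls) (_ , ∈-map⁺ ((b , b ∷ P) ⊕_) L″∈ , ∈ₗ-⊕ (b , b ∷ P) L″ pu pw λ i →
                ≡-trans (eq i) (≡-trans (cong (ℤ._+ y i) (e i)) (ℤₚ.+-assoc (u i) (v i) (y i))))
  star-snoc {x} {y} {z} ((b , P) ∷ Ls) _ (_ , _ , q) eq | inj₂ L∈ | _ | L′ , L′∈ , refl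
          | u , v , pu , pv , e | here refl =
              ∈ₛ-++ʳ (star Ls) (_ , ∈-map⁺ ((b , b ∷ P) ⊕_) L′∈ ,
                ∈ₗ-⊕ {x = λ i → u i ℤ.+ y i} (b , b ∷ P) L′ (repeat pu q) pv λ i →
                ≡-trans (eq i) (≡-trans (cong (ℤ._+ y i) (e i)) (lem (u i) (v i) (y i))))
    where
    lem : ∀ u v y → (u ℤ.+ v) ℤ.+ y ≡ (u ℤ.+ y) ℤ.+ v
    lem = solve-∀
    repeat : ∀ {u y} → u ∈ₗ (b , b ∷ P) → y ∈ₗ (b , P) → (λ i → u i ℤ.+ y i) ∈ₗ (b , b ∷ P)
    repeat (c , cc , e) (c′ , cc′ , e′) =
      _ , cone-+ cc (cons (here refl) (cone-mono there cc′) (λ _ → refl)) , λ i →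
      ≡-trans (cong₂ ℤ._+_ (e i) (e′ i)) (ℤₚ.+-assoc (b i) (c i) (b i ℤ.+ c′ i))

  star-elim : (Q : ℤVec d → Set) → (∀ {x y} → Q x → (∀ i → y i ≡ x i) → Q y) →
    Q (λ _ → 0ℤ) → (∀ {x y} → Q x → Q y → Q (λ i → x i ℤ.+ y i)) →
    ∀ Ls → (∀ {x} → x ∈ₛ Ls → Q x) → ∀ {x} → x ∈ₛ star Ls → Q x
  star-elim Q resp Q0 Q+ [] f (_ , here refl , c , nil e , e′) =
    resp Q0 λ i → ≡-trans (e′ i) (cong (ℤ._+_ 0ℤ) (e i))
  star-elim Q resp Q0 Q+ ((b , P) ∷ Ls) f (L , L∈ , p) with ∈-++⁻ (star Ls) L∈
  ... | inj₁ L∈ = star-elim Q resp Q0 Q+ Ls (λ (M , M∈ , q) → f (M , there M∈ , q)) (L , L∈ , p)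
  ... | inj₂ L∈ with ∈-map⁻ ((b , b ∷ P) ⊕_) L∈
  ...   | L′ , L′∈ , refl with ⊕-split (b , b ∷ P) L′ p
  ...     | u , v , (c , cc , e) , pv , e′ =
            resp (Q+ (multiple cc e) (star-elim Q resp Q0 Q+ Ls
              (λ (M , M∈ , q) → f (M , there M∈ , q)) (L′ , L′∈ , pv))) e′
    where
    Qb : Q b
    Qb = f (_ , here refl , (λ _ → 0ℤ) , nil (λ _ → refl) , λ i → sym (ℤₚ.+-identityʳ (b i)))
    one : ∀ {x c} → Cone P c → (∀ i → x i ≡ b i ℤ.+ c i) → Q x
    one cc e = f (_ , here refl , _ , cc , e)
    assoc : ∀ a b c → a ℤ.+ (b ℤ.+ c) ≡ b ℤ.+ (a ℤ.+ c)
    assoc = solve-∀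
    -- Each extra copy of `b` is an element of the linear set by itself; the periods are set aside,
    -- to be attached to the one mandatory copy of `b`.
    collect : ∀ {c} → Cone (b ∷ P) c → ∃ λ u → ∃ λ w → (Q u) × Cone P w × (∀ i → c i ≡ u i ℤ.+ w i)
    collect (nil e) = (λ _ → 0ℤ) , (λ _ → 0ℤ) , Q0 , nil (λ _ → refl) , e
    collect (cons (here refl) cc e) with collect cc
    ... | u , w , qu , cw , e′ = _ , w , Q+ Qb qu , cw , λ i →
          ≡-trans (e i) (≡-trans (cong (ℤ._+_ (b i)) (e′ i)) (sym (ℤₚ.+-assoc (b i) (u i) (w i))))
    collect (cons {g} (there g∈) cc e) with collect cc
    ... | u , w , qu , cw , e′ = u , _ , qu , cons g∈ cw (λ _ → refl) , λ i →
          ≡-trans (e i) (≡-trans (cong (ℤ._+_ (g i)) (e′ i)) (assoc (g i) (u i) (w i)))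
    multiple : ∀ {x c} → Cone (b ∷ P) c → (∀ i → x i ≡ b i ℤ.+ c i) → Q x
    multiple cc e with collect cc
    ... | u , w , qu , cw , e′ = resp (Q+ qu (one cw λ _ → refl)) λ i →
          ≡-trans (e i) (≡-trans (cong (ℤ._+_ (b i)) (e′ i)) (assoc (b i) (u i) (w i)))

module Walks {d : ℕ} {V : Set} (_≟_ : DecidableEquality V)
             (vs : List V) (complete : ∀ v → v ∈ vs)
             (E : V → List (V × ℤVec d)) where

  open Linear {d}

  -- Walks are nonempty, and only their inner vertices are confined to `K`: this is the parameter of
  -- Kleene's recursion.
  data WalkIn (K : List V) (i j : V) (x : ℤVec d) : Set where
    edge : ∀ {z} → (j , z) ∈ E i → (∀ a → x a ≡ z a) → WalkIn K i j x
    step : ∀ {k z y} → (k , z) ∈ E i → k ∈ K → WalkIn K k j y →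
           (∀ a → x a ≡ z a ℤ.+ y a) → WalkIn K i j x

  Walk : V → V → ℤVec d → Set
  Walk = WalkIn vs

  walk-resp : ∀ {i j x y} → Walk i j x → (∀ a → y a ≡ x a) → Walk i j y
  walk-resp (edge m e) eq = edge m λ a → ≡-trans (eq a) (e a)
  walk-resp (step m k∈ w e) eq = step m k∈ w λ a → ≡-trans (eq a) (e a)

  _◅◅_ : ∀ {i j k x y} → Walk i j x → Walk j k y → Walk i k (λ a → x a ℤ.+ y a)
  _◅◅_ {y = y} (edge m e) w′ = step m (complete _) w′ λ a → cong (ℤ._+ y a) (e a)
  _◅◅_ {y = y} (step {z = z} {u} m k∈ w e) w′ = step m k∈ (w ◅◅ w′) λ a →
    ≡-trans (cong (ℤ._+ y a) (e a)) (ℤₚ.+-assoc (z a) (u a) (y a))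

  closed-multiple : ∀ {i x} n → Walk i i x → Walk i i (λ a → + suc n ℤ.* x a)
  closed-multiple {x = x} zero w = walk-resp w λ a → ℤₚ.*-identityˡ (x a)
  closed-multiple {x = x} (suc n) w =
    walk-resp (w ◅◅ closed-multiple n w) λ a → ℤₚ.suc-* (+ suc n) (x a)

  effects : List V → V → V → List LinearSet
  effects [] i j = map (λ m → proj₂ m , []) (filter (λ m → proj₁ m ≟ j) (E i))
  effects (k ∷ K) i j =
    effects K i j ++ (effects K i k ⊗ (star (effects K k k) ⊗ effects K k j))

  effects-sound : ∀ K {i j x} → x ∈ₛ effects K i j → Walk i j x
  effects-sound [] {i} {j} (_ , L∈ , c , cc , e) with ∈-map⁻ _ L∈
  ... | (k , z) , m∈ , refl with ∈-filter⁻ (λ m → proj₁ m ≟ j) {xs = E i} m∈ | cc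
  ...   | m∈ , refl | nil e′ =
          edge m∈ λ a → ≡-trans (e a) (≡-trans (cong (ℤ._+_ (z a)) (e′ a)) (ℤₚ.+-identityʳ (z a)))
  effects-sound (k ∷ K) {i} {j} (L , L∈ , p) with ∈-++⁻ (effects K i j) L∈
  ... | inj₁ L∈ = effects-sound K (L , L∈ , p)
  ... | inj₂ L∈ with ⊗-split (effects K i k) _ (L , L∈ , p)
  ...   | x , y , px , py , e with ⊗-split (star (effects K k k)) _ py
  ...     | u , w , pu , pw , e′ with closed pu
    where
    -- The star contains the empty sum, which no nonempty walk accounts for.
    ClosedOrEmpty : ℤVec d → Set
    ClosedOrEmpty x = (∀ a → x a ≡ 0ℤ) ⊎ Walk k k x
    append : ∀ {x y} → ClosedOrEmpty x → ClosedOrEmpty y → ClosedOrEmpty (λ a → x a ℤ.+ y a)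
    append {x} {y} (inj₁ e) (inj₁ e′) = inj₁ λ a → cong₂ ℤ._+_ (e a) (e′ a)
    append {x} {y} (inj₁ e) (inj₂ w) = inj₂ (walk-resp w λ a →
      ≡-trans (cong (ℤ._+ y a) (e a)) (ℤₚ.+-identityˡ (y a)))
    append {x} {y} (inj₂ w) (inj₁ e) = inj₂ (walk-resp w λ a →
      ≡-trans (cong (ℤ._+_ (x a)) (e a)) (ℤₚ.+-identityʳ (x a)))
    append (inj₂ w) (inj₂ w′) = inj₂ (w ◅◅ w′)
    closed : ∀ {u} → u ∈ₛ star (effects K k k) → ClosedOrEmpty u
    closed = star-elim ClosedOrEmpty
      (λ { (inj₁ e) eq → inj₁ λ a → ≡-trans (eq a) (e a) ; (inj₂ w) eq → inj₂ (walk-resp w eq) })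
      (inj₁ λ _ → refl) append (effects K k k) (λ p → inj₂ (effects-sound K p))
  ...       | inj₁ u≡0 = walk-resp (effects-sound K px ◅◅ effects-sound K pw) λ a →
              ≡-trans (e a) (cong (ℤ._+_ (x a)) (≡-trans (e′ a)
                (≡-trans (cong (ℤ._+ w a) (u≡0 a)) (ℤₚ.+-identityˡ (w a)))))
  ...       | inj₂ wu = walk-resp (effects-sound K px ◅◅ (wu ◅◅ effects-sound K pw)) λ a →
              ≡-trans (e a) (cong (ℤ._+_ (x a)) (e′ a))

  effects-complete : ∀ K {i j x} → WalkIn K i j x → x ∈ₛ effects K i j

  data Split (k : V) (K : List V) (i j : V) (x : ℤVec d) : Set where
    avoid : WalkIn K i j x → Split k K i j x
    visit : ∀ {u v w} → WalkIn K i k u → v ∈ₛ star (effects K k k) → WalkIn K k j w →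
            (∀ a → x a ≡ u a ℤ.+ (v a ℤ.+ w a)) → Split k K i j x

  split : ∀ {k K i j x} → WalkIn (k ∷ K) i j x → Split k K i j x
  split (edge m e) = avoid (edge m e)
  split {k} {K} (step {z = z} {y} m (here refl) w e) with split w
  ... | avoid w = visit (edge m λ _ → refl) (star-zero {x = λ _ → 0ℤ} (effects K k k) λ _ → refl) w λ a →
        ≡-trans (e a) (cong (ℤ._+_ (z a)) (sym (ℤₚ.+-identityˡ (y a))))
  -- The tail starts at `k`, so its first segment `p` is a closed walk and joins the star; the order
  -- is irrelevant because effects commute.
  ... | visit {u} {v} {w} p q r e′ =
        visit (edge m λ _ → refl)
          (star-snoc {z = λ a → v a ℤ.+ u a} (effects K k k) q (effects-complete K p) (λ _ → refl)) r
          λ a → ≡-trans (e a) (cong (ℤ._+_ (z a)) (≡-trans (e′ a) (lem (u a) (v a) (w a))))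
    where
    lem : ∀ u v w → u ℤ.+ (v ℤ.+ w) ≡ (v ℤ.+ u) ℤ.+ w
    lem = solve-∀
  split (step {z = z} m (there k∈) w e) with split w
  ... | avoid w = avoid (step m k∈ w e)
  ... | visit {u} {v} {w} p q r e′ = visit (step m k∈ p λ _ → refl) q r λ a →
        ≡-trans (e a) (≡-trans (cong (ℤ._+_ (z a)) (e′ a)) (sym (ℤₚ.+-assoc (z a) (u a) (v a ℤ.+ w a))))

  effects-complete [] {i} {j} (edge {z} m e) =
    _ , ∈-map⁺ (λ m → proj₂ m , []) (∈-filter⁺ (λ m → proj₁ m ≟ j) m refl) ,
    (λ _ → 0ℤ) , nil (λ _ → refl) , λ a → ≡-trans (e a) (sym (ℤₚ.+-identityʳ (z a)))
  effects-complete [] (step _ () _ _)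
  effects-complete (k ∷ K) {i} {j} w with split w
  ... | avoid w = ∈ₛ-++ˡ (effects-complete K w)
  ... | visit {v = v} {w} p q r e =
        ∈ₛ-++ʳ (effects K i j) (∈ₛ-⊗ {y = λ a → v a ℤ.+ w a} (effects-complete K p)
          (∈ₛ-⊗ q (effects-complete K r) λ _ → refl) e)

  -- Every linear set contains its base, so a walk exists exactly when the list of linear sets is
  -- nonempty.
  walk? : ∀ i j → (∃ λ x → Walk i j x) ⊎ (∀ x → ¬ Walk i j x)
  walk? i j with effects vs i j in eq
  ... | [] = inj₂ λ x w →
        case subst (x ∈ₛ_) eq (effects-complete vs w) of λ { (_ , () , _) }
  ... | (b , P) ∷ Ls = inj₁ (b , effects-sound vs (subst (b ∈ₛ_) (sym eq)
        (_ , here refl , (λ _ → 0ℤ) , nil (λ _ → refl) , λ i → sym (ℤₚ.+-identityʳ (b i)))))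

  NonnegativeCycle : V → Set
  NonnegativeCycle f = ∃ λ x → Walk f f x × (∀ a → 0ℤ ℤ.≤ x a)

  -- Closed walks at f are closed under addition, so a nonnegative rational
  -- combination with positive weight on the base can be scaled to a closed walk.
  nonnegative-cycle? : ∀ f → NonnegativeCycle f ⊎ ¬ NonnegativeCycle f
  nonnegative-cycle? f = search (effects vs f f) (λ L∈ → L∈)
    λ (x , w , 0≤x) → x , effects-complete vs w , 0≤x
    where
    search : ∀ Ls → (∀ {L} → L ∈ Ls → L ∈ effects vs f f) →
             (NonnegativeCycle f → ∃ λ x → (x ∈ₛ Ls) × (∀ a → 0ℤ ℤ.≤ x a)) →
             NonnegativeCycle f ⊎ ¬ NonnegativeCycle f
    search [] sub c = inj₂ λ p → case c p of λ { (_ , (_ , () , _) , _) }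
    search ((b , P) ∷ Ls) sub c with nonnegative-linear b P
    ... | inj₁ (n , u , cu , 0≤) = inj₁ (_ , cycle n , 0≤)
      where
      wb : Walk f f b
      wb = effects-sound vs
        (_ , sub (here refl) , (λ _ → 0ℤ) , nil (λ _ → refl) , λ i → sym (ℤₚ.+-identityʳ (b i)))
      wu : Walk f f (λ a → b a ℤ.+ u a)
      wu = effects-sound vs (_ , sub (here refl) , u , cu , λ _ → refl)
      lem : ∀ n b u → (1ℤ ℤ.+ n) ℤ.* b ℤ.+ u ≡ n ℤ.* b ℤ.+ (b ℤ.+ u)
      lem = solve-∀
      cycle : ∀ n → Walk f f (λ a → + suc n ℤ.* b a ℤ.+ u a)
      cycle zero = walk-resp wu λ a → cong (ℤ._+ u a) (ℤₚ.*-identityˡ (b a))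
      cycle (suc n) = walk-resp (closed-multiple n wb ◅◅ wu) λ a → lem (+ suc n) (b a) (u a)
    ... | inj₂ none = search Ls (sub ∘ there) λ p → tail (c p)
      where
      tail : (∃ λ x → (x ∈ₛ ((b , P) ∷ Ls)) × (∀ a → 0ℤ ℤ.≤ x a)) →
             ∃ λ x → (x ∈ₛ Ls) × (∀ a → 0ℤ ℤ.≤ x a)
      tail (x , (_ , here refl , u , cu , e) , 0≤x) =
        ⊥-elim (none u cu λ a → subst (0ℤ ℤ.≤_) (e a) (0≤x a))
      tail (x , (L , there L∈ , p) , 0≤x) = x , (L , L∈ , p) , 0≤x

-- Dickson's lemma

-- Almost full relations (Vytiniotis, Coquand and Wahlstedt): every sequence,
-- in the inductive sense, has a pair of positions i < j related by R.
data AlmostFull {A : Set} (R : A → A → Set) : Set₁ where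
  now   : (∀ x y → R x y) → AlmostFull R
  later : (∀ x → AlmostFull λ y z → R y z ⊎ R x y) → AlmostFull R

module _ {A : Set} where

  private variable
    R S C T U : A → A → Set

  af-mono : (∀ {x y} → R x y → S x y) → AlmostFull R → AlmostFull S
  af-mono f (now r) = now λ x y → f (r x y)
  af-mono f (later r) = later λ x → af-mono (Sum.map f f) (r x)

  private
    meet : ∀ {X P Q : Set} → X ⊎ P → X ⊎ Q → X ⊎ (P × Q)
    meet (inj₁ c) _ = inj₁ c
    meet (inj₂ _) (inj₁ c) = inj₁ c
    meet (inj₂ p) (inj₂ q) = inj₂ (p , q)

    exchange : ∀ {X Y Z : Set} → (X ⊎ Y) ⊎ Z → (X ⊎ Z) ⊎ Y
    exchange (inj₁ (inj₁ a)) = inj₁ (inj₁ a)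
    exchange (inj₁ (inj₂ b)) = inj₂ b
    exchange (inj₂ c) = inj₁ (inj₂ c)

    regroup : ∀ {C C′ P PQ : Set} → ((C ⊎ C′) ⊎ PQ) ⊎ P → (C ⊎ PQ) ⊎ (C′ ⊎ P)
    regroup (inj₁ (inj₁ (inj₁ c))) = inj₁ (inj₁ c)
    regroup (inj₁ (inj₁ (inj₂ c))) = inj₂ (inj₁ c)
    regroup (inj₁ (inj₂ pq)) = inj₁ (inj₂ pq)
    regroup (inj₂ p) = inj₂ (inj₂ p)

  -- Closure under intersection is an intuitionistic Ramsey theorem, proved by arity: an element
  -- fixed by `later` turns a binary `R` into the unary `R x`, and a unary `P` into the proposition
  -- `P x`. `C` collects what has already been achieved.
  af-const : ∀ {P Q : Set} → AlmostFull T → AlmostFull U →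
    (∀ {x y} → T x y → C x y ⊎ P) → (∀ {x y} → U x y → C x y ⊎ Q) →
    AlmostFull λ x y → C x y ⊎ (P × Q)
  af-const (now t) afU f g = af-mono (λ {x} {y} u → meet (f (t x y)) (g u)) afU
  af-const (later t) afU f g = later λ x →
    af-mono (λ { (inj₁ (inj₁ c)) → inj₁ (inj₁ c)
               ; (inj₁ (inj₂ c)) → inj₂ (inj₁ c)
               ; (inj₂ pq) → inj₁ (inj₂ pq) })
      (af-const (t x) afU
        (λ { (inj₁ r) → map₁ inj₁ (f r) ; (inj₂ r) → map₁ inj₂ (f r) })
        (λ u → map₁ inj₁ (g u)))

  af-unary : ∀ {P Q : A → Set} → AlmostFull T → AlmostFull U →
    (∀ {x y} → T x y → C x y ⊎ P x) → (∀ {x y} → U x y → C x y ⊎ Q x) →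
    AlmostFull λ x y → C x y ⊎ (P x × Q x)
  af-unary (now t) afU f g = af-mono (λ {x} {y} u → meet (f (t x y)) (g u)) afU
  af-unary afT@(later _) (now u) f g = af-mono (λ {x} {y} t → meet (f t) (g (u x y))) afT
  af-unary {C = C} {P = P} {Q} (later t) (later u) f g = later λ x →
    af-mono regroup
      (af-const {C = λ y z → (C y z ⊎ C x y) ⊎ (P y × Q y)} {P = P x} {Q = Q x}
        (af-unary {C = λ y z → (C y z ⊎ C x y) ⊎ P x} {P = P} {Q = Q} (t x) (later u)
          (λ { (inj₁ r) → map₁ (inj₁ ∘ inj₁) (f r) ; (inj₂ r) → inj₁ (map₁ inj₂ (f r)) })
          (λ r → map₁ (inj₁ ∘ inj₁) (g r)))
        (af-unary {C = λ y z → (C y z ⊎ C x y) ⊎ Q x} {P = P} {Q = Q} (later t) (u x)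
          (λ r → map₁ (inj₁ ∘ inj₁) (f r))
          (λ { (inj₁ r) → map₁ (inj₁ ∘ inj₁) (g r) ; (inj₂ r) → inj₁ (map₁ inj₂ (g r)) }))
        exchange exchange)

  af-binary : AlmostFull T → AlmostFull U →
    (∀ {x y} → T x y → C x y ⊎ R x y) → (∀ {x y} → U x y → C x y ⊎ S x y) →
    AlmostFull λ x y → C x y ⊎ (R x y × S x y)
  af-binary (now t) afU f g = af-mono (λ {x} {y} u → meet (f (t x y)) (g u)) afU
  af-binary afT@(later _) (now u) f g = af-mono (λ {x} {y} t → meet (f t) (g (u x y))) afT
  af-binary {C = C} {R = R} {S = S} (later t) (later u) f g = later λ x →
    af-mono regroup
      (af-unary {C = λ y z → (C y z ⊎ C x y) ⊎ (R y z × S y z)} {P = R x} {Q = S x}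
        (af-binary {C = λ y z → (C y z ⊎ C x y) ⊎ R x y} {R = R} {S = S} (t x) (later u)
          (λ { (inj₁ r) → map₁ (inj₁ ∘ inj₁) (f r) ; (inj₂ r) → inj₁ (map₁ inj₂ (f r)) })
          (λ r → map₁ (inj₁ ∘ inj₁) (g r)))
        (af-binary {C = λ y z → (C y z ⊎ C x y) ⊎ S x y} {R = R} {S = S} (later t) (u x)
          (λ r → map₁ (inj₁ ∘ inj₁) (f r))
          (λ { (inj₁ r) → map₁ (inj₁ ∘ inj₁) (g r) ; (inj₂ r) → inj₁ (map₁ inj₂ (g r)) }))
        exchange exchange)

  af-∩ : AlmostFull R → AlmostFull S → AlmostFull λ x y → R x y × S x y
  af-∩ afR afS = af-mono (λ { (inj₂ rs) → rs })
    (af-binary {C = λ _ _ → ⊥} afR afS inj₂ inj₂)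

af-on : ∀ {A B : Set} {R : B → B → Set} (f : A → B) → AlmostFull R →
        AlmostFull λ x y → R (f x) (f y)
af-on f (now r) = now λ x y → r (f x) (f y)
af-on f (later r) = later λ x → af-on f (r (f x))

-- Well-founded induction on the first element `x`: the next one is at least `x`, which is a good
-- pair, or it is smaller and the induction hypothesis for it applies.
af-≤ : AlmostFull _≤_
af-≤ = later (<-rec (λ x → AlmostFull λ y z → y ≤ z ⊎ x ≤ y)
  λ x rec → later λ y → above x rec y (x ℕ.≤? y))
  where
  above : ∀ x → (∀ {y} → y < x → AlmostFull λ z w → z ≤ w ⊎ y ≤ z) → ∀ y → Dec (x ≤ y) →
         AlmostFull λ z w → (z ≤ w ⊎ x ≤ z) ⊎ (y ≤ z ⊎ x ≤ y)
  above x rec y (yes x≤y) = now λ _ _ → inj₂ (inj₂ x≤y)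
  above x rec y (no x≰y) =
    af-mono (λ { (inj₁ p) → inj₁ (inj₁ p) ; (inj₂ p) → inj₂ (inj₁ p) }) (rec (ℕₚ.≰⇒> x≰y))

dickson : ∀ d → AlmostFull λ (x y : Fin d → ℕ) → ∀ i → x i ≤ y i
dickson zero = now λ _ _ ()
dickson (suc d) = af-mono (λ { (p , q) zero → p ; (p , q) (suc i) → q i })
  (af-∩ (af-on (λ x → x zero) af-≤) (af-on (λ x i → x (suc i)) (dickson d)))

-- Energy games

record Upd {d} (v : Vec ℕ d) (z : ℤVec d) (v′ : Vec ℕ d) : Set where
  constructor upd
  field at : ∀ i → + lookup v′ i ≡ + lookup v i ℤ.+ z i
open Upd

update : ∀ {d} (v : Vec ℕ d) (z : ℤVec d) → (∀ i → 0ℤ ℤ.≤ + lookup v i ℤ.+ z i) →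
         ∃ λ v′ → Upd v z v′
update v z 0≤ = tabulate (λ i → ∣ + lookup v i ℤ.+ z i ∣) , upd λ i →
  ≡-trans (cong +_ (lookup∘tabulate _ i)) (ℤₚ.0≤i⇒+∣i∣≡i (0≤ i))

∣∣-drop : ∀ {n m} z → ∣ z ∣ ℕ.+ n ≤ m → + n ℤ.≤ + m ℤ.+ z
∣∣-drop {n} {m} (+ k) p =
  +≤+ (ℕₚ.≤-trans (ℕₚ.m≤n+m n k) (ℕₚ.≤-trans p (ℕₚ.m≤m+n m k)))
∣∣-drop {n} {m} (ℤ.-[1+ k ]) p = subst (+ n ℤ.≤_)
  (sym (ℤₚ.⊖-≥ (ℕₚ.≤-trans (ℕₚ.m≤m+n (suc k) n) p)))
  (+≤+ (subst (_≤ m ∸ suc k) (ℕₚ.m+n∸m≡n (suc k) n) (ℕₚ.∸-monoˡ-≤ (suc k) p)))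

-- Moves of the opponent are never blocked: he wins at once if he has a move that
-- makes a counter negative.
module Energy {d : ℕ} {V : Set} (F : V → Bool) where

  Move Node Game Pos : Set
  Move = V × ℤVec d
  Node = Player × List Move
  Game = V → Node
  Pos = V × Vec ℕ d

  private variable
    ℓ ℓ′ : Level
    N N′ : Node
    G G′ : Game
    v : Vec ℕ d
    c : Pos

  -- The witness `m₀` excludes opponent vertices without moves, since a deadlock must count as a
  -- loss of Player 1.
  data Forces (X : Pos → Set) (v : Vec ℕ d) (N : Node) : Set where
    choose : ∀ {m v′} → proj₁ N ≡ player1 → m ∈ proj₂ N → Upd v (proj₂ m) v′ →
             X (proj₁ m , v′) → Forces X v N
    forced : ∀ {m₀} → proj₁ N ≡ prob → m₀ ∈ proj₂ N →
             (next : ∀ m → m ∈ proj₂ N → Vec ℕ d) →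
             (∀ m m∈ → Upd v (proj₂ m) (next m m∈)) →
             (∀ m m∈ → X (proj₁ m , next m m∈)) → Forces X v N

  -- Quantifying over `v′` is vacuous for a move that would make a counter negative: Player 1 cannot
  -- use such a move, and the opponent wins with it.
  data Avoids (Z : Pos → Set ℓ) (v : Vec ℕ d) (N : Node) : Set ℓ where
    all  : proj₁ N ≡ player1 →
           (∀ m → m ∈ proj₂ N → ∀ v′ → Upd v (proj₂ m) v′ → Z (proj₁ m , v′)) → Avoids Z v N
    some : ∀ {m} → proj₁ N ≡ prob → m ∈ proj₂ N →
           (∀ v′ → Upd v (proj₂ m) v′ → Z (proj₁ m , v′)) → Avoids Z v N
    none : proj₁ N ≡ prob → proj₂ N ≡ [] → Avoids Z v N

  avoids-map : ∀ {Z : Pos → Set ℓ} {Z′ : Pos → Set ℓ′} → (∀ {c} → Z c → Z′ c) →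
               Avoids Z v N → Avoids Z′ v N
  avoids-map f (all e g) = all e λ m m∈ v′ u → f (g m m∈ v′ u)
  avoids-map f (some e m∈ g) = some e m∈ λ v′ u → f (g v′ u)
  avoids-map f (none e e′) = none e e′

  -- Visits to X only count after at least one step.
  data Attr (G : Game) (X : Pos → Set) (c : Pos) : Set where
    reach : Forces (λ c′ → X c′ ⊎ Attr G X c′) (proj₂ c) (G (proj₁ c)) → Attr G X c

  module _ {X : Pos → Set} (P : Pos → Set)
           (alg : ∀ {q v} → Forces (λ c → X c ⊎ P c) v (G q) → P (q , v)) where

    attr-fold  : Attr G X c → P c
    attr-fold⊎ : X c ⊎ Attr G X c → X c ⊎ P c

    attr-fold (reach (choose e m∈ u x)) = alg (choose e m∈ u (attr-fold⊎ x))
    attr-fold (reach (forced e m∈ n u x)) = alg (forced e m∈ n u λ m m∈ → attr-fold⊎ (x m m∈))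
    attr-fold⊎ (inj₁ x) = inj₁ x
    attr-fold⊎ (inj₂ t) = inj₂ (attr-fold t)

  forces-map : ∀ {X X′ : Pos → Set} → (∀ {c} → X c → X′ c) → Forces X v N → Forces X′ v N
  forces-map f (choose e m∈ u x) = choose e m∈ u (f x)
  forces-map f (forced e m∈ n u x) = forced e m∈ n u λ m m∈ → f (x m m∈)

  attr-map : ∀ {X X′ : Pos → Set} → (∀ {c} → X c → X′ c) → Attr G X c → Attr G X′ c
  attr-map f = attr-fold _ λ t → reach (forces-map (map₁ f) t)

  attr-simulate : ∀ {X : Pos → Set} →
    (∀ {q v} {X : Pos → Set} → Forces X v (G q) → Forces X v (G′ q)) → Attr G X c → Attr G′ X c
  attr-simulate sim = attr-fold _ λ t → reach (sim t)

  Final : (Pos → Set) → Pos → Set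
  Final X c = F (proj₁ c) ≡ true × X c

  Closed : Game → (Pos → Set) → Set
  Closed G Inv = ∀ {c} → Inv c → Attr G (Final Inv) c

  -- A least fixpoint around a greatest one: the opponent keeps the play in Y,
  -- outside of F, until it possibly moves on to a smaller certificate.
  data Lose (G : Game) (c : Pos) : Set₁ where
    trap : (Y : Pos → Set) → Y c →
           (∀ {c′} → Y c′ → Avoids (λ c″ → Lose G c″ ⊎ (F (proj₁ c″) ≡ false × Y c″))
                                   (proj₂ c′) (G (proj₁ c′))) →
           Lose G c

  module _ (P : Pos → Set ℓ)
           (alg : ∀ (Y : Pos → Set) →
             (∀ {c′} → Y c′ → Avoids (λ c″ → P c″ ⊎ (F (proj₁ c″) ≡ false × Y c″))
                                     (proj₂ c′) (G (proj₁ c′))) →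
             ∀ {c} → Y c → P c) where

    lose-fold : Lose G c → P c
    lose-fold-avoids : ∀ {Y : Pos → Set} →
                       Avoids (λ c → Lose G c ⊎ Y c) v N → Avoids (λ c → P c ⊎ Y c) v N
    lose-fold⊎ : ∀ {Y : Pos → Set} → Lose G c ⊎ Y c → P c ⊎ Y c

    lose-fold (trap Y y st) = alg Y (λ y → lose-fold-avoids (st y)) y
    lose-fold-avoids {Y = Y} (all e f) = all e λ m m∈ v′ u → lose-fold⊎ {Y = Y} (f m m∈ v′ u)
    lose-fold-avoids {Y = Y} (some e m∈ f) = some e m∈ λ v′ u → lose-fold⊎ {Y = Y} (f v′ u)
    lose-fold-avoids (none e e′) = none e e′
    lose-fold⊎ (inj₁ l) = inj₁ (lose-fold l)
    lose-fold⊎ (inj₂ y) = inj₂ y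

  lose-simulate :
    (∀ {q v} {Z : Pos → Set₁} → Avoids Z v (G q) → Avoids Z v (G′ q)) → Lose G c → Lose G′ c
  lose-simulate sim = lose-fold _ λ Y st y → trap Y y λ y → sim (st y)

  lose-unfold : Lose G c → Avoids (Lose G) (proj₂ c) (G (proj₁ c))
  lose-unfold (trap Y y st) =
    avoids-map (λ { (inj₁ l) → l ; (inj₂ (_ , y)) → trap Y y st }) (st y)

  record Solved (G : Game) : Set₁ where
    field
      Inv      : Pos → Set
      closed   : Closed G Inv
      decision : ∀ q → (∃ λ w → Inv (q , w)) ⊎ (∀ w → Lose G (q , w))

  -- Games without opponent

  module OnePlayer (_≟_ : DecidableEquality V) (vs : List V) (complete : ∀ v → v ∈ vs)
                   (G : Game) (one : ∀ q → proj₁ (G q) ≡ player1) where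

    open Walks _≟_ vs complete (λ q → proj₂ (G q))

    -- A crude bound on how far a counter can fall along any prefix of the walk.
    cost : ∀ {i j x} → Walk i j x → Fin d → ℕ
    cost (edge {z} _ _) a = ∣ z a ∣
    cost (step {z = z} _ _ w _) a = ∣ z a ∣ ℕ.+ cost w a

    cost-bound : ∀ {i j x n m} (w : Walk i j x) a → cost w a ℕ.+ n ≤ m → + n ℤ.≤ + m ℤ.+ x a
    cost-bound {n = n} {m} (edge {z} _ e) a p =
      subst (λ x → + n ℤ.≤ + m ℤ.+ x) (sym (e a)) (∣∣-drop (z a) p)
    cost-bound {x = x} {n} {m} (step {z = z} {y} _ _ w e) a p = subst (+ n ℤ.≤_)
      (≡-trans (cong (ℤ._+ y a) (ℤₚ.0≤i⇒+∣i∣≡i 0≤))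
        (≡-trans (ℤₚ.+-assoc (+ m) (z a) (y a)) (cong (ℤ._+_ (+ m)) (sym (e a)))))
      (cost-bound w a (ℤₚ.drop‿+≤+ (subst (+ (cost w a ℕ.+ n) ℤ.≤_) (sym (ℤₚ.0≤i⇒+∣i∣≡i 0≤)) q)))
      where
      q : + (cost w a ℕ.+ n) ℤ.≤ + m ℤ.+ z a
      q = ∣∣-drop (z a) (subst (_≤ m) (ℕₚ.+-assoc (∣ z a ∣) (cost w a) n) p)
      0≤ : 0ℤ ℤ.≤ + m ℤ.+ z a
      0≤ = ℤₚ.≤-trans (+≤+ z≤n) q

    follow : ∀ {i j x v} {X : Pos → Set} (w : Walk i j x) → (∀ a → cost w a ≤ lookup v a) →
             (∀ {v′} → Upd v x v′ → X (j , v′)) → Attr G X (i , v)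
    follow {i} {v = v} (edge {z} m∈ e) p f
      with update v z (λ a → ∣∣-drop (z a) (subst (_≤ lookup v a) (sym (ℕₚ.+-identityʳ _)) (p a)))
    ... | v′ , u = reach (choose (one i) m∈ u
          (inj₁ (f (upd λ a → ≡-trans (at u a) (cong (ℤ._+_ (+ lookup v a)) (sym (e a)))))))
    follow {i} {v = v} (step {z = z} {y} m∈ _ w e) p f
      with update v z (λ a → ℤₚ.≤-trans (+≤+ z≤n) (∣∣-drop (z a) (p a)))
    ... | v′ , u = reach (choose (one i) m∈ u (inj₂ (follow w
          (λ a → ℤₚ.drop‿+≤+ (subst (+ cost w a ℤ.≤_) (sym (at u a)) (∣∣-drop (z a) (p a))))
          λ {v″} u′ → f (upd λ a → ≡-trans (at u′ a) (≡-trans (cong (ℤ._+ y a) (at u a))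
            (≡-trans (ℤₚ.+-assoc (+ lookup v a) (z a) (y a))
              (cong (ℤ._+_ (+ lookup v a)) (sym (e a)))))))))

    -- Player 1 follows `walk` to a final vertex and then repeats `cycle`. `cyclable` says that the
    -- counters left on arrival pay for one round; as a round loses nothing, they pay for all, and
    -- `cycle` serves as the next `walk`.
    record Inv (c : Pos) : Set where
      constructor inv
      field
        {f}       : V
        final     : F f ≡ true
        {x₀ x}    : ℤVec d
        cycle     : Walk f f x₀
        cycle≥0   : ∀ a → 0ℤ ℤ.≤ x₀ a
        walk      : Walk (proj₁ c) f x
        walkable  : ∀ a → cost walk a ≤ lookup (proj₂ c) a
        cyclable  : ∀ a → + cost cycle a ℤ.≤ + lookup (proj₂ c) a ℤ.+ x a

    Inv-closed : Closed G Inv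
    Inv-closed (inv final cycle cycle≥0 walk walkable cyclable) = follow walk walkable
      λ {v′} u → let cost≤ = λ a → subst (+ cost cycle a ℤ.≤_) (sym (at u a)) (cyclable a) in
      final , inv final cycle cycle≥0 cycle (λ a → ℤₚ.drop‿+≤+ (cost≤ a))
        λ a → ℤₚ.≤-trans (ℤₚ.≤-reflexive (sym (ℤₚ.+-identityʳ _))) (ℤₚ.+-mono-≤ (cost≤ a) (cycle≥0 a))

    Path : Pos → Pos → Set
    Path (q , v) (q′ , v′) = ∃ λ x → Walk q q′ x × Upd v x v′

    path-trans : ∀ {c c′ c″} → Path c c′ → Path c′ c″ → Path c c″
    path-trans {_ , v} (x , w , u) (y , w′ , u′) = _ , w ◅◅ w′ , upd λ a →
      ≡-trans (at u′ a) (≡-trans (cong (ℤ._+ y a) (at u a)) (ℤₚ.+-assoc (+ lookup v a) (x a) (y a)))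

    path-step : ∀ {c q v m v′} → (q , v) ≡ c ⊎ Path c (q , v) → m ∈ proj₂ (G q) →
                Upd v (proj₂ m) v′ → Path c (proj₁ m , v′)
    path-step (inj₁ refl) m∈ u = _ , edge m∈ (λ _ → refl) , u
    path-step (inj₂ p) m∈ u = path-trans p (_ , edge m∈ (λ _ → refl) , u)

    FinalPair : (Pos → Pos → Set) → Pos → Set
    FinalPair R c = ∃ λ x → ∃ λ y → F (proj₁ x) ≡ true × F (proj₁ y) ≡ true ×
                    Path c x × Path x y × R x y

    -- Without opponent the set of all reachable positions is closed under moves, so it is a trap as
    -- soon as its final positions are lost.
    dodge : ∀ {c} → (∀ {c′} → Path c c′ → F (proj₁ c′) ≡ true → Lose G c′) → Lose G c
    dodge {c} f = trap (λ c′ → c′ ≡ c ⊎ Path c c′) (inj₁ refl) λ {(q , v)} y →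
      all (one q) λ m m∈ v′ u → classify (path-step y m∈ u) (F (proj₁ m)) refl
      where
      classify : ∀ {c′} → Path c c′ → ∀ b → F (proj₁ c′) ≡ b →
        Lose G c′ ⊎ (F (proj₁ c′) ≡ false × (c′ ≡ c ⊎ Path c c′))
      classify p true e = inj₁ (f p e)
      classify p false e = inj₂ (e , inj₂ p)

    -- Induction on the almost full tree: every visit to `F` consumes one `later`, which records the
    -- visited position in the relation. At `now` any two further visits would form a pair.
    no-pair⇒lose : ∀ {R} → AlmostFull R → ∀ c → ¬ FinalPair R c → Lose G c
    no-pair⇒lose (now r) c ¬p = dodge λ {c′} p e → dodge λ {c″} p′ e′ →
      ⊥-elim (¬p (c′ , c″ , e , e′ , p , p′ , r c′ c″))
    no-pair⇒lose (later r) c ¬p = dodge λ {c′} p e → no-pair⇒lose (r c′) c′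
      λ { (x , y , ex , ey , px , py , inj₁ Rxy) → ¬p (x , y , ex , ey , path-trans p px , py , Rxy)
        ; (x , y , ex , ey , px , py , inj₂ Rcx) → ¬p (c′ , x , e , ex , p , px , Rcx) }

    _⊑_ : Pos → Pos → Set
    (q , v) ⊑ (q′ , v′) = q ≡ q′ × ∀ i → lookup v i ≤ lookup v′ i

    index : V → Fin (length vs)
    index q = Any.index (complete q)

    -- ≤ between both an index and its complement forces equality of states.
    coordinates : Pos → Fin (suc (suc d)) → ℕ
    coordinates (q , v) zero = toℕ (index q)
    coordinates (q , v) (suc zero) = length vs ∸ toℕ (index q)
    coordinates (q , v) (suc (suc i)) = lookup v i

    af-⊑ : AlmostFull _⊑_
    af-⊑ = af-mono (λ {x} {y} → decode {x} {y}) (af-on coordinates (dickson (suc (suc d))))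
      where
      decode : ∀ {x y} → (∀ i → coordinates x i ≤ coordinates y i) → x ⊑ y
      decode {q , v} {q′ , v′} le =
        ≡-trans (lookup-index (complete q))
          (≡-trans (cong (List.lookup vs) same) (sym (lookup-index (complete q′)))) ,
        λ i → le (suc (suc i))
        where
        same : index q ≡ index q′
        same = Finₚ.toℕ-injective (ℕₚ.≤-antisym (le zero)
          (ℕₚ.≮⇒≥ λ q<q′ → ℕₚ.<⇒≱
            (ℕₚ.∸-monoʳ-< q<q′ (ℕₚ.<⇒≤ (Finₚ.toℕ<n (index q′)))) (le (suc zero))))

    solved : Solved G
    solved = record { Inv = Inv ; closed = Inv-closed ; decision = decide }
      where
      Good : V → V → Set
      Good q f = F f ≡ true × (∃ λ x → Walk q f x) × NonnegativeCycle f
      good? : ∀ q f → Good q f ⊎ ¬ Good q f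
      good? q f with F f in e | walk? q f | nonnegative-cycle? f
      ... | false | _ | _ = inj₂ λ ()
      ... | true | inj₂ ¬w | _ = inj₂ λ (_ , (x , w) , _) → ¬w x w
      ... | true | inj₁ _ | inj₂ ¬c = inj₂ λ (_ , _ , c) → ¬c c
      ... | true | inj₁ w | inj₁ c = inj₁ (refl , w , c)
      search : ∀ q fs → (∃ (Good q)) ⊎ (∀ f → f ∈ fs → ¬ Good q f)
      search q [] = inj₂ λ _ ()
      search q (f ∷ fs) with good? q f | search q fs
      ... | inj₁ g | _ = inj₁ (f , g)
      ... | inj₂ _ | inj₁ g = inj₁ g
      ... | inj₂ ¬g | inj₂ ¬gs = inj₂ λ { _ (here refl) → ¬g ; f (there f∈) → ¬gs f f∈ }
      decide : ∀ q → (∃ λ w → Inv (q , w)) ⊎ (∀ w → Lose G (q , w))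
      decide q with search q vs
      ... | inj₁ (f , final , (x , w) , (x₀ , c , c≥0)) =
            -- The first summand pays for the way to `f`; by `cost-bound` the second is still there
            -- on arrival.
            inj₁ (tabulate (λ a → cost w a ℕ.+ cost c a) , inv final c c≥0 w
              (λ a → subst (cost w a ≤_) (sym (lookup∘tabulate _ a)) (ℕₚ.m≤m+n _ _))
              (λ a → cost-bound w a (ℕₚ.≤-reflexive (sym (lookup∘tabulate _ a)))))
      -- Two related final visits are at the same vertex `f`, so the walk between them is closed,
      -- with effect equal to the growth of the counters.
      ... | inj₂ ¬g = inj₂ λ w → no-pair⇒lose af-⊑ (q , w) λ
            { ((f , v) , (_ , v′) , e , _ , (x , p , _) , (y , p′ , u) , refl , v≤v′) →
              ¬g f (complete f) (e , (x , p) , y , p′ , λ a → nonneg (at u a) (v≤v′ a)) }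
        where
        nonneg : ∀ {m n y} → + n ≡ + m ℤ.+ y → m ≤ n → 0ℤ ℤ.≤ y
        nonneg {m} {n} {y} e m≤n = subst (0ℤ ℤ.≤_)
          (≡-trans (cong (ℤ._- + m) e) (lem (+ m) y)) (ℤₚ.i≤j⇒0≤j-i (+≤+ m≤n))
          where
          lem : ∀ a b → a ℤ.+ b ℤ.- a ≡ b
          lem = solve-∀

-- Unknown initial credit

module UnknownCredit {d : ℕ} {V : Set} (F : V → Bool) (_≟_ : DecidableEquality V)
                     (vs : List V) (complete : ∀ v → v ∈ vs) where

  open Energy {d} F
  open Solved

  _[_≔_] : Game → V → Node → Game
  (G [ p ≔ N ]) q with q ≟ p
  ... | yes _ = N
  ... | no _ = G q

  ≔-same : ∀ G p N → (G [ p ≔ N ]) p ≡ N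
  ≔-same G p N with p ≟ p
  ... | yes _ = refl
  ... | no p≢p = ⊥-elim (p≢p refl)

  ≔-other : ∀ G p N {q} → q ≢ p → (G [ p ≔ N ]) q ≡ G q
  ≔-other G p N {q} q≢p with q ≟ p
  ... | yes q≡p = ⊥-elim (q≢p q≡p)
  ... | no _ = refl

  ≔-forces : ∀ {G p N} → (∀ {v X} → Forces X v N → Forces X v (G p)) →
             ∀ {q v X} → Forces X v ((G [ p ≔ N ]) q) → Forces X v (G q)
  ≔-forces {G} {p} {N} f {q} t with q ≟ p
  ... | yes refl = f t
  ... | no _ = t

  ≔-avoids : ∀ {G p N} → (∀ {v} {Z : Pos → Set₁} → Avoids Z v N → Avoids Z v (G p)) →
             ∀ {q v} {Z : Pos → Set₁} → Avoids Z v ((G [ p ≔ N ]) q) → Avoids Z v (G q)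
  ≔-avoids {G} {p} {N} f {q} t with q ≟ p
  ... | yes refl = f t
  ... | no _ = t

  -- The opponent chooses at p between e and the moves es. Player 1 suspends a
  -- play of the game where p has only e and a play of the game where p has only
  -- es, each with its own share of the counters, and resumes the one that
  -- matches the choice.
  module Shuffle (G : Game) (p : V) (e : Move) (es : List Move) (at-p : G p ≡ (prob , e ∷ es))
                 (Inv₁ Inv₂ : Pos → Set) where

    G₁ G₂ : Game
    G₁ = G [ p ≔ (player1 , e ∷ []) ]
    G₂ = G [ p ≔ (prob , es) ]

    X₁ X₂ : Pos → Set
    X₁ = Final Inv₁
    X₂ = Final Inv₂

    record IsSum (v a b : Vec ℕ d) : Set where
      constructor sum
      field at : ∀ i → lookup v i ≡ lookup a i ℕ.+ lookup b i

    -- The active play is in its invariant, while the other waits at `p` with the unfinished tree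
    -- that leads to its own next visit to `F`.
    data Shuffled (c : Pos) : Set where
      run₁ : ∀ {a b} → IsSum (proj₂ c) a b → Inv₁ (proj₁ c , a) → Attr G₂ X₂ (p , b) → Shuffled c
      run₂ : ∀ {a b} → IsSum (proj₂ c) a b → Attr G₁ X₁ (p , a) → Inv₂ (proj₁ c , b) → Shuffled c

    Target : Pos → Set
    Target c = Final Shuffled c ⊎ Attr G (Final Shuffled) c

    advance : ∀ {v a b z a′} → IsSum v a b → Upd a z a′ → ∃ λ v′ → Upd v z v′ × IsSum v′ a′ b
    advance {v} {a} {b} {z} {a′} s u =
      tabulate v′ , upd (λ i → ≡-trans (cong +_ (lookup∘tabulate v′ i)) (eq i)) ,
      sum (lookup∘tabulate v′)
      where
      v′ : Fin d → ℕ
      v′ i = lookup a′ i ℕ.+ lookup b i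
      lem : ∀ a z b → (a ℤ.+ z) ℤ.+ b ≡ (a ℤ.+ b) ℤ.+ z
      lem = solve-∀
      eq : ∀ i → + v′ i ≡ + lookup v i ℤ.+ z i
      eq i = ≡-trans (cong (ℤ._+ + lookup b i) (Upd.at u i))
        (≡-trans (lem (+ lookup a i) (z i) (+ lookup b i))
          (cong (λ n → + n ℤ.+ z i) (sym (IsSum.at s i))))

    sum-comm : ∀ {v a b} → IsSum v a b → IsSum v b a
    sum-comm {a = a} {b} s = sum λ i → ≡-trans (IsSum.at s i) (ℕₚ.+-comm (lookup a i) (lookup b i))

    -- Every move descends in one of the two well-founded trees and leaves the other untouched, so
    -- after finitely many moves one of the plays visits `F`, whatever the opponent's switches at
    -- `p`.
    shuffle₁ : ∀ {q v a b} → IsSum v a b → Attr G₁ X₁ (q , a) → Attr G₂ X₂ (p , b) →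
               Attr G (Final Shuffled) (q , v)
    shuffle₂ : ∀ {q v a b} → IsSum v a b → Attr G₁ X₁ (p , a) → Attr G₂ X₂ (q , b) →
               Attr G (Final Shuffled) (q , v)
    shuffleₚ : ∀ {v a b} → IsSum v a b → Attr G₁ X₁ (p , a) → Attr G₂ X₂ (p , b) →
               Attr G (Final Shuffled) (p , v)
    branch : ∀ {v a b} → IsSum v a b → Attr G₁ X₁ (p , a) → Attr G₂ X₂ (p , b) →
             ∀ m → m ∈ e ∷ es → ∃ λ v′ → Upd v (proj₂ m) v′ × Target (proj₁ m , v′)
    resume₁ : ∀ {q v a b} → IsSum v a b → X₁ (q , a) ⊎ Attr G₁ X₁ (q , a) → Attr G₂ X₂ (p , b) →
              Target (q , v)
    resume₂ : ∀ {q v a b} → IsSum v a b → Attr G₁ X₁ (p , a) → X₂ (q , b) ⊎ Attr G₂ X₂ (q , b) →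
              Target (q , v)

    resume₁ s (inj₁ (f , i)) t₂ = inj₁ (f , run₁ s i t₂)
    resume₁ s (inj₂ t₁) t₂ = inj₂ (shuffle₁ s t₁ t₂)
    resume₂ s t₁ (inj₁ (f , i)) = inj₁ (f , run₂ s t₁ i)
    resume₂ s t₁ (inj₂ t₂) = inj₂ (shuffle₂ s t₁ t₂)

    shuffle₁ {q} s t₁ t₂ with q ≟ p
    ... | yes refl = shuffleₚ s t₁ t₂
    shuffle₁ {q} s (reach (choose o m∈ u x)) t₂ | no q≢p =
      let N≡ = ≔-other G p (player1 , e ∷ []) q≢p ; (v′ , u′ , s′) = advance s u in
      reach (choose (≡-trans (cong proj₁ (sym N≡)) o) (subst (λ N → _ ∈ proj₂ N) N≡ m∈) u′
        (resume₁ s′ x t₂))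
    shuffle₁ {q} {v} s (reach (forced o m∈ n u x)) t₂ | no q≢p =
      reach (forced (≡-trans (cong proj₁ (sym N≡)) o) (subst (λ N → _ ∈ proj₂ N) N≡ m∈)
        (λ m h → proj₁ (adv m h)) (λ m h → proj₁ (proj₂ (adv m h)))
        (λ m h → resume₁ (proj₂ (proj₂ (adv m h))) (x m (back h)) t₂))
      where
      N≡ = ≔-other G p (player1 , e ∷ []) q≢p
      back : ∀ {m} → m ∈ proj₂ (G q) → m ∈ proj₂ (G₁ q)
      back = subst (λ N → _ ∈ proj₂ N) (sym N≡)
      adv = λ m h → advance {v = v} s (u m (back h))

    shuffle₂ {q} s t₁ t₂ with q ≟ p
    ... | yes refl = shuffleₚ s t₁ t₂
    shuffle₂ {q} s t₁ (reach (choose o m∈ u x)) | no q≢p =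
      let N≡ = ≔-other G p (prob , es) q≢p ; (v′ , u′ , s′) = advance (sum-comm s) u in
      reach (choose (≡-trans (cong proj₁ (sym N≡)) o) (subst (λ N → _ ∈ proj₂ N) N≡ m∈) u′
        (resume₂ (sum-comm s′) t₁ x))
    shuffle₂ {q} {v} s t₁ (reach (forced o m∈ n u x)) | no q≢p =
      reach (forced (≡-trans (cong proj₁ (sym N≡)) o) (subst (λ N → _ ∈ proj₂ N) N≡ m∈)
        (λ m h → proj₁ (adv m h)) (λ m h → proj₁ (proj₂ (adv m h)))
        (λ m h → resume₂ (sum-comm (proj₂ (proj₂ (adv m h)))) t₁ (x m (back h))))
      where
      N≡ = ≔-other G p (prob , es) q≢p
      back : ∀ {m} → m ∈ proj₂ (G q) → m ∈ proj₂ (G₂ q)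
      back = subst (λ N → _ ∈ proj₂ N) (sym N≡)
      adv = λ m h → advance {v = v} (sum-comm s) (u m (back h))

    shuffleₚ s t₁ t₂ = reach (forced (cong proj₁ at-p) (subst (λ N → e ∈ proj₂ N) (sym at-p) (here refl))
      (λ m h → proj₁ (branch s t₁ t₂ m (outside h)))
      (λ m h → proj₁ (proj₂ (branch s t₁ t₂ m (outside h))))
      (λ m h → proj₂ (proj₂ (branch s t₁ t₂ m (outside h)))))
      where
      outside : ∀ {m} → m ∈ proj₂ (G p) → m ∈ e ∷ es
      outside = subst (λ N → _ ∈ proj₂ N) at-p

    branch s (reach (forced o _ _ _ _)) _ _ (here _)
      with ≡-trans (sym o) (cong proj₁ (≔-same G p (player1 , e ∷ [])))
    ... | ()
    branch s (reach (choose _ m∈ u x)) t₂ _ (here refl)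
      with subst (λ N → _ ∈ proj₂ N) (≔-same G p (player1 , e ∷ [])) m∈
    ... | here refl = let (v′ , u′ , s′) = advance s u in v′ , u′ , resume₁ s′ x t₂
    branch s _ (reach (choose o _ _ _)) _ (there _)
      with ≡-trans (sym o) (cong proj₁ (≔-same G p (prob , es)))
    ... | ()
    branch s t₁ (reach (forced _ _ _ u x)) m (there h) =
      let h′ = subst (λ N → m ∈ proj₂ N) (sym (≔-same G p (prob , es))) h
          (v′ , u′ , s′) = advance (sum-comm s) (u m h′) in
      v′ , u′ , resume₂ (sum-comm s′) t₁ (x m h′)

    Shuffled-closed : Closed G₁ Inv₁ → Closed G₂ Inv₂ → Closed G Shuffled
    Shuffled-closed c₁ c₂ (run₁ s i t₂) = shuffle₁ s (c₁ i) t₂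
    Shuffled-closed c₁ c₂ (run₂ s t₁ i) = shuffle₂ s t₁ (c₂ i)

  -- With at most one move the owner is immaterial: Player 1 loses under either owner when there is
  -- no move or the only move makes a counter negative.
  solve-as-player1 : ∀ {G p} → G p ≡ (prob , []) ⊎ (∃ λ e → G p ≡ (prob , e ∷ [])) →
    Solved (G [ p ≔ (player1 , proj₂ (G p)) ]) → Solved G
  solve-as-player1 {G} {p} G-p S = record
    { Inv = Inv S
    ; closed = λ i → attr-simulate (≔-forces {G} {p} (forces G-p)) (closed S i)
    ; decision = λ q → map₂ (λ l w → lose-simulate (≔-avoids {G} {p} (avoids G-p)) (l w)) (decision S q)
    }
    where
    forces : ∀ {N} → N ≡ (prob , []) ⊎ (∃ λ e → N ≡ (prob , e ∷ [])) →
             ∀ {v X} → Forces X v (player1 , proj₂ N) → Forces X v N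
    forces (inj₁ refl) (choose _ () _ _)
    forces (inj₂ (e , refl)) (choose {v′ = v′} _ (here refl) u x) =
      forced refl (here refl) (λ _ _ → v′) (λ { _ (here refl) → u }) (λ { _ (here refl) → x })
    avoids : ∀ {N} → N ≡ (prob , []) ⊎ (∃ λ e → N ≡ (prob , e ∷ [])) →
             ∀ {v} {Z : Pos → Set₁} → Avoids Z v (player1 , proj₂ N) → Avoids Z v N
    avoids (inj₁ refl) _ = none refl refl
    avoids (inj₂ (e , refl)) (all _ f) = some refl (here refl) (f e (here refl))

  -- A certificate for the changed game may be kept as it is away from `p`; at `p` the play moves on
  -- to the losses given by the hypothesis.
  lose-if-loses-at : ∀ {G p N} → (∀ w → Lose G (p , w)) → ∀ {c} → Lose (G [ p ≔ N ]) c → Lose G c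
  lose-if-loses-at {G} {p} {N} lp = lose-fold _ λ Y st y → trap Y y λ {c} y → convert c (st y)
    where
    convert : ∀ {Y : Pos → Set} c →
      Avoids (λ c → Lose G c ⊎ Y c) (proj₂ c) ((G [ p ≔ N ]) (proj₁ c)) →
      Avoids (λ c → Lose G c ⊎ Y c) (proj₂ c) (G (proj₁ c))
    convert (q , v) a with q ≟ p
    ... | yes refl = avoids-map inj₁ (lose-unfold (lp v))
    ... | no _ = a

  -- If `p` loses with every credit in one of the first two subgames, it does so in `G`, and the
  -- third subgame, where `p` is a dead end, settles all vertices. Otherwise both subgames can be
  -- won from `p`, and the plays are shuffled.
  solve-choice : ∀ {G p e es} → G p ≡ (prob , e ∷ es) → es ≢ [] →
    Solved (G [ p ≔ (player1 , e ∷ []) ]) → Solved (G [ p ≔ (prob , es) ]) →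
    Solved (G [ p ≔ (player1 , []) ]) → Solved G
  solve-choice {G} {p} {e} {es} at-p es≢[] S₁ S₂ S₃ = combine (decision S₁ p) (decision S₂ p)
    where
    lose₁ : ∀ {c} → Lose (G [ p ≔ (player1 , e ∷ []) ]) c → Lose G c
    lose₁ = lose-simulate (≔-avoids {G} {p} avoids)
      where
      avoids : ∀ {v} {Z : Pos → Set₁} → Avoids Z v (player1 , e ∷ []) → Avoids Z v (G p)
      avoids {v} {Z} (all _ f) =
        subst (Avoids Z v) (sym at-p) (some refl (here refl) (f e (here refl)))
    lose₂ : ∀ {c} → Lose (G [ p ≔ (prob , es) ]) c → Lose G c
    lose₂ = lose-simulate (≔-avoids {G} {p} avoids)
      where
      avoids : ∀ {v} {Z : Pos → Set₁} → Avoids Z v (prob , es) → Avoids Z v (G p)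
      avoids {v} {Z} (some _ m∈ f) = subst (Avoids Z v) (sym at-p) (some refl (there m∈) f)
      avoids (none _ es≡[]) = ⊥-elim (es≢[] es≡[])
    via₃ : (∀ w → Lose G (p , w)) → Solved G
    via₃ lp = record
      { Inv = Inv S₃
      ; closed = λ i → attr-simulate
          (≔-forces {G} {p} λ { (choose _ () _ _) ; (forced () _ _ _ _) }) (closed S₃ i)
      ; decision = λ q → map₂ (λ l w → lose-if-loses-at lp (l w)) (decision S₃ q)
      }
    Decision : (G : Game) → (Pos → Set) → V → Set₁
    Decision G Inv q = (∃ λ w → Inv (q , w)) ⊎ (∀ w → Lose G (q , w))
    combine : Decision (G [ p ≔ (player1 , e ∷ []) ]) (Inv S₁) p →
              Decision (G [ p ≔ (prob , es) ]) (Inv S₂) p → Solved G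
    combine (inj₂ l₁) _ = via₃ λ w → lose₁ (l₁ w)
    combine (inj₁ _) (inj₂ l₂) = via₃ λ w → lose₂ (l₂ w)
    combine (inj₁ _) (inj₁ (b , i₂)) = record
      { Inv = Shuffled
      ; closed = Shuffled-closed (closed S₁) (closed S₂)
      ; decision = λ q → decide (decision S₁ q)
      }
      where
      open Shuffle G p e es at-p (Inv S₁) (Inv S₂)
      -- The first subgame settles every vertex: a win there only has to be supplemented by the
      -- share `b` of the play waiting at `p`, and a loss carries over because the opponent may
      -- always choose `e`.
      decide : ∀ {q} → Decision G₁ (Inv S₁) q → Decision G Shuffled q
      decide (inj₁ (a , i₁)) =
        inj₁ (tabulate (λ j → lookup a j ℕ.+ lookup b j) ,
              run₁ (sum (lookup∘tabulate _)) i₁ (closed S₂ i₂))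
      decide (inj₂ l) = inj₂ λ w → lose₁ (l w)

  mutual
    -- `ps` contains all remaining opponent vertices. Each subgame either shortens this list or
    -- leaves the current vertex with fewer choices.
    solve-list : ∀ ps G → (∀ q → proj₁ (G q) ≡ prob → q ∈ ps) → Solved G
    solve-list [] G adv = OnePlayer.solved _≟_ vs complete G λ q → is-player1 q (proj₁ (G q)) refl
      where
      is-player1 : ∀ q o → proj₁ (G q) ≡ o → proj₁ (G q) ≡ player1
      is-player1 q player1 e = e
      is-player1 q prob e with adv q e
      ... | ()
    solve-list (p ∷ ps) G adv = solve-at p ps (proj₂ (G p)) G (proj₁ (G p)) refl adv

    solve-at : ∀ p ps ms G o → G p ≡ (o , ms) → (∀ q → proj₁ (G q) ≡ prob → q ∈ p ∷ ps) → Solved G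
    solve-at p ps ms G player1 at-p adv = solve-list ps G λ q e → skip q e (adv q e)
      where
      skip : ∀ q → proj₁ (G q) ≡ prob → q ∈ p ∷ ps → q ∈ ps
      skip q e (there q∈) = q∈
      skip q e (here refl) with ≡-trans (sym e) (cong proj₁ at-p)
      ... | ()
    solve-at p ps [] G prob at-p adv =
      solve-as-player1 (inj₁ at-p) (solve-list ps _ (replaced p ps G _ adv))
    solve-at p ps (e ∷ []) G prob at-p adv =
      solve-as-player1 (inj₂ (e , at-p)) (solve-list ps _ (replaced p ps G _ adv))
    solve-at p ps (e ∷ es@(_ ∷ _)) G prob at-p adv = solve-choice at-p (λ ())
      (solve-list ps _ (replaced p ps G _ adv))
      (solve-at p ps es (G [ p ≔ (prob , es) ]) prob (≔-same G p _) adv′)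
      (solve-list ps _ (replaced p ps G _ adv))
      where
      adv′ : ∀ q → proj₁ ((G [ p ≔ (prob , es) ]) q) ≡ prob → q ∈ p ∷ ps
      adv′ q e with q ≟ p
      ... | yes refl = here refl
      ... | no _ = adv q e

    replaced : ∀ p ps G ms → (∀ q → proj₁ (G q) ≡ prob → q ∈ p ∷ ps) →
               ∀ q → proj₁ ((G [ p ≔ (player1 , ms) ]) q) ≡ prob → q ∈ ps
    replaced p ps G ms adv q e with q ≟ p
    replaced p ps G ms adv q () | yes _
    ... | no q≢p with adv q e
    ...   | here q≡p = ⊥-elim (q≢p q≡p)
    ...   | there q∈ = q∈

  abstract
    solve : ∀ G → Solved G
    solve G = solve-list vs G λ q _ → complete q

-- Fixed initial credit

bound : ∀ {A : Set} (f : A → ℕ) (xs : List A) → ∃ λ B → ∀ {x} → x ∈ xs → f x ≤ B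
bound f [] = 0 , λ ()
bound f (x ∷ xs) with bound f xs
... | B , p = f x ⊔ B , λ { (here refl) → ℕₚ.m≤m⊔n (f x) B
                          ; (there x∈) → ℕₚ.≤-trans (p x∈) (ℕₚ.m≤n⊔m (f x) B) }

vectors : ∀ {A : Set} → List A → ∀ n → List (Vec A n)
vectors xs zero = [] ∷ []
vectors xs (suc n) = cartesianProductWith _∷_ xs (vectors xs n)

vectors-complete : ∀ {A : Set} {xs : List A} → (∀ x → x ∈ xs) → ∀ {n} (v : Vec A n) → v ∈ vectors xs n
vectors-complete c [] = here refl
vectors-complete c (x ∷ v) = ∈-cartesianProductWith⁺ _∷_ (c x) (vectors-complete c v)

clamp : ∀ B → ℕ → Fin (suc B)
clamp B n = fromℕ< (s≤s (ℕₚ.m⊓n≤m B n))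

toℕ-clamp : ∀ {B n} → n ≤ B → toℕ (clamp B n) ≡ n
toℕ-clamp n≤B = ≡-trans (Finₚ.toℕ-fromℕ< _) (ℕₚ.m≥n⇒m⊓n≡n n≤B)

module KnownCredit {d : ℕ} {V : Set} (F : V → Bool) (_≟_ : DecidableEquality V)
                   (vs : List V) (complete : ∀ v → v ∈ vs) (G : Energy.Game {d} F) where

  open Energy {d} F hiding (Solved; module OnePlayer)

  -- A win is stated for all vectors at least `v` on `J`, because lifted arena plays only bound the
  -- counters from below; a loss is stated at the exact values. When `J` contains all counters, each
  -- yields a verdict on `v` itself.
  Suffices : Subset d → ℕ → (Pos → Set) → Pos → Set
  Suffices J B Inv (q , v) = ∀ v′ → (∀ {j} → j ∈ˢ J → lookup v j ≤ lookup v′ j) →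
                                    (∀ {j} → j ∉ˢ J → B ≤ lookup v′ j) → Inv (q , v′)

  Hopeless : Subset d → Pos → Set₁
  Hopeless J (q , v) = ∀ v′ → (∀ {j} → j ∈ˢ J → lookup v′ j ≡ lookup v j) → Lose G (q , v′)

  -- Counters outside J are existentially quantified; B is a value that is
  -- sufficient for them whenever some value is.
  record Cutoff (J : Subset d) : Set₁ where
    field
      Inv    : Pos → Set
      closed : Closed G Inv
      B      : ℕ
      decision : ∀ c → Suffices J B Inv c ⊎ Hopeless J c

  -- Rackoff's argument: once a tracked counter exceeds B₀ it need not be tracked
  -- any more, so the tracked counters are encoded in a finite arena, on
  -- which the remaining counters form a game with unknown initial credit.
  module Extend (J : Subset d) (rec : ∀ j → j ∈ˢ J → Cutoff (J ⊖ j)) where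
    module Rec j (j∈ : j ∈ˢ J) = Cutoff (rec j j∈)

    dropB : Fin d → ℕ
    dropB j with j ∈? J
    ... | yes j∈ = Rec.B j j∈
    ... | no _ = 0

    -- The maximum of the cutoffs for all smaller sets: above it a counter is large enough to be
    -- forgotten, whichever it is.
    B₀ : ℕ
    B₀ = proj₁ (bound dropB (allFin d))

    B≤B₀ : ∀ j j∈ → Rec.B j j∈ ≤ B₀
    B≤B₀ j j∈ = subst (_≤ B₀) eq (proj₂ (bound dropB (allFin d)) (∈-allFin j))
      where
      eq : dropB j ≡ Rec.B j j∈
      eq with j ∈? J
      ... | yes j∈′ = cong (Rec.B j) ([]=-irrelevant j∈′ j∈)
      ... | no j∉ = ⊥-elim (j∉ j∈)

    DropInv : Pos → Set
    DropInv c = ∃ λ j → ∃ λ j∈ → Rec.Inv j j∈ c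

    DropInv-closed : Closed G DropInv
    DropInv-closed (j , j∈ , i) = attr-map (λ (f , i) → f , j , j∈ , i) (Rec.closed j j∈ i)

    -- Counter `j` exceeds the cutoff for `J ⊖ j`, so a win found without tracking it applies here.
    -- A loss found there holds for all values of `j`, including the current one.
    drop-decision : ∀ {j} → j ∈ˢ J → ∀ q v → B₀ < lookup v j →
                    Suffices J B₀ DropInv (q , v) ⊎ Hopeless J (q , v)
    drop-decision {j} j∈ q v big = Sum.map
        (λ f v′ ge ge₀ → j , j∈ , f v′ (λ i∈ → ge (drop-⊆ i∈)) (large v′ ge ge₀))
        (λ l v′ e → l v′ λ i∈ → e (drop-⊆ i∈))
        (Rec.decision j j∈ (q , v))
      where
      drop-⊆ : ∀ {i} → i ∈ˢ J ⊖ j → i ∈ˢ J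
      drop-⊆ = p─q⊆p J Subset.⁅ j ⁆
      large : ∀ v′ → (∀ {j} → j ∈ˢ J → lookup v j ≤ lookup v′ j) →
              (∀ {j} → j ∉ˢ J → B₀ ≤ lookup v′ j) →
              ∀ {i} → i ∉ˢ J ⊖ j → Rec.B j j∈ ≤ lookup v′ i
      large v′ ge ge₀ {i} i∉ with i ∈? J | i Finₚ.≟ j
      ... | no i∉J | _ = ℕₚ.≤-trans (B≤B₀ j j∈) (ge₀ i∉J)
      ... | yes _ | yes refl = ℕₚ.≤-trans (B≤B₀ j j∈) (ℕₚ.≤-trans (ℕₚ.<⇒≤ big) (ge j∈))
      ... | yes i∈J | no i≢j = ⊥-elim (i∉ (x∈p∧x≢y⇒x∈p-y i∈J i≢j))

    Box : Set
    Box = Vec (Fin (suc B₀)) d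

    val : Box → Fin d → ℕ
    val u i = toℕ (lookup u i)

    box : (Fin d → ℕ) → Box
    box f = tabulate (clamp B₀ ∘ f)

    val-box : ∀ f {i} → f i ≤ B₀ → val (box f) i ≡ f i
    val-box f {i} p = ≡-trans (cong toℕ (lookup∘tabulate (clamp B₀ ∘ f) i)) (toℕ-clamp p)

    -- inj₁ true and inj₁ false are sinks won by Player 1 and by the opponent.
    Vertex : Set
    Vertex = Bool ⊎ (V × Box)

    Fₛ : Vertex → Bool
    Fₛ (inj₁ b) = b
    Fₛ (inj₂ (q , _)) = F q

    _≟ₛ_ : DecidableEquality Vertex
    _≟ₛ_ = Sumₚ.≡-dec Bool._≟_ (Productₚ.≡-dec _≟_ (≡-dec Finₚ._≟_))

    states : List Vertex
    states = inj₁ true ∷ inj₁ false ∷ map inj₂ (cartesianProduct vs (vectors (allFin (suc B₀)) d))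

    states-complete : ∀ a → a ∈ states
    states-complete (inj₁ true) = here refl
    states-complete (inj₁ false) = there (here refl)
    states-complete (inj₂ (q , u)) = there (there (∈-map⁺ inj₂
      (∈-cartesianProduct⁺ (complete q) (vectors-complete ∈-allFin u))))

    -- Tracked counters live in the box; as counters of the arena they are frozen.
    mask : ℤVec d → ℤVec d
    mask z i with i ∈? J
    ... | yes _ = 0ℤ
    ... | no _ = z i

    mask-∉ : ∀ z {i} → i ∉ˢ J → mask z i ≡ z i
    mask-∉ z {i} i∉ with i ∈? J
    ... | yes i∈ = ⊥-elim (i∉ i∈)
    ... | no _ = refl

    -- Each arena successor carries its justification in `G`, to be read both when a winning play is
    -- lifted and when a trap is brought down.
    data Next (q : V) (z : ℤVec d) (u : Box) : Vertex → Set₁ where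
      won  : (∀ {i} → i ∈ˢ J → 0ℤ ℤ.≤ + val u i ℤ.+ z i) →
             (∀ {v} → (∀ {i} → i ∈ˢ J → + val u i ℤ.+ z i ℤ.≤ + lookup v i) →
                      (∀ {i} → i ∉ˢ J → B₀ ≤ lookup v i) → DropInv (q , v)) →
             Next q z u (inj₁ true)
      lost : (∀ {v} → (∀ {i} → i ∈ˢ J → + lookup v i ≡ + val u i ℤ.+ z i) → Lose G (q , v)) →
             Next q z u (inj₁ false)
      stay : ∀ {u′} → (∀ {i} → i ∈ˢ J → + val u′ i ≡ + val u i ℤ.+ z i) →
             Next q z u (inj₂ (q , u′))

    next : ∀ q z u → ∃ (Next q z u)
    next q z u with Finₚ.any? (λ i → (i ∈? J) ×-dec (+ val u i ℤ.+ z i ℤ.<? 0ℤ))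
    -- No vector has a negative entry, so the claim of `lost` is vacuous.
    ... | yes (i , i∈ , neg) = inj₁ false , lost λ {v} e →
          ⊥-elim (ℤₚ.<⇒≱ (subst (ℤ._< 0ℤ) (sym (e i∈)) neg) (+≤+ z≤n))
    ... | no ¬neg with Finₚ.any? (λ i → (i ∈? J) ×-dec (B₀ ℕ.<? ∣ + val u i ℤ.+ z i ∣))
    ...   | no ¬big = _ , stay {u′ = box λ i → ∣ + val u i ℤ.+ z i ∣} λ {i} i∈ →
            ≡-trans (cong +_ (val-box _ (ℕₚ.≮⇒≥ λ big → ¬big (i , i∈ , big))))
                  (ℤₚ.0≤i⇒+∣i∣≡i (ℤₚ.≮⇒≥ λ neg → ¬neg (i , i∈ , neg)))
    ...   | yes (j , j∈ , big) =
            exit (drop-decision j∈ q v (subst (B₀ <_) (sym (lookup∘tabulate _ j)) big))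
      where
      v : Vec ℕ d
      -- Entries outside `J` are filler, which neither `Suffices` nor `Hopeless` looks at.
      v = tabulate λ i → ∣ + val u i ℤ.+ z i ∣
      nonneg : ∀ {i} → i ∈ˢ J → 0ℤ ℤ.≤ + val u i ℤ.+ z i
      nonneg {i} i∈ = ℤₚ.≮⇒≥ λ neg → ¬neg (i , i∈ , neg)
      eq : ∀ {i} → i ∈ˢ J → + lookup v i ≡ + val u i ℤ.+ z i
      eq {i} i∈ = ≡-trans (cong +_ (lookup∘tabulate _ i)) (ℤₚ.0≤i⇒+∣i∣≡i (nonneg i∈))
      exit : Suffices J B₀ DropInv (q , v) ⊎ Hopeless J (q , v) → ∃ (Next q z u)
      exit (inj₁ f) = inj₁ true , won nonneg λ {v′} ge → f v′ λ {i} i∈ →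
        ℤₚ.drop‿+≤+ (subst (ℤ._≤ + lookup v′ i) (sym (eq i∈)) (ge i∈))
      exit (inj₂ l) = inj₁ false , lost λ {v′} e → l v′ λ i∈ →
        ℤₚ.+-injective (≡-trans (e i∈) (sym (eq i∈)))

    module H = Energy {d} Fₛ

    arena-move : Box → Move → H.Move
    arena-move u (q , z) = proj₁ (next q z u) , mask z

    arena : H.Game
    arena (inj₁ true) = player1 , (inj₁ true , λ _ → 0ℤ) ∷ []
    arena (inj₁ false) = player1 , []
    arena (inj₂ (q , u)) = proj₁ (G q) , map (arena-move u) (proj₂ (G q))

    solved : H.Solved arena
    solved = UnknownCredit.solve Fₛ _≟ₛ_ states states-complete arena

    module Sol = H.Solved solved

    -- The reserve `B₀` is never spent, since `w` alone pays for the arena play. On exit to the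
    -- winning sink it is what `Suffices J B₀` demands of the untracked counters.
    record Above (u : Box) (w v : Vec ℕ d) : Set where
      constructor above
      field
        tracked   : ∀ {i} → i ∈ˢ J → val u i ≤ lookup v i
        untracked : ∀ {i} → i ∉ˢ J → lookup w i ℕ.+ B₀ ≤ lookup v i

    Inv : Pos → Set
    Inv (q , v) = DropInv (q , v) ⊎ (∃ λ u → ∃ λ w → Sol.Inv (inj₂ (q , u) , w) × Above u w v)

    Target : Pos → Set
    Target c = Final Inv c ⊎ Attr G (Final Inv) c

    Lifted : H.Pos → Set
    Lifted (inj₁ true , w) = ⊤
    Lifted (inj₁ false , w) = ⊥
    Lifted (inj₂ (q , u) , w) = ∀ v → Above u w v → Attr G (Final Inv) (q , v)

    lift-move : ∀ {q z u w w′ v a} → Next q z u a → Above u w v → Upd w (mask z) w′ →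
      H.Final Sol.Inv (a , w′) ⊎ Lifted (a , w′) → ∃ λ v′ → Upd v z v′ × Target (q , v′)
    lift-move {q} {z} {u} {w} {w′} {v} nx (above tr un) up x = continue nx x
      where
      w′-eq : ∀ {i} → i ∉ˢ J → + lookup w′ i ≡ + lookup w i ℤ.+ z i
      w′-eq {i} i∉ = ≡-trans (Upd.at up i) (cong (ℤ._+_ (+ lookup w i)) (mask-∉ z i∉))
      untracked≥ : ∀ {i} → i ∉ˢ J → + (lookup w′ i ℕ.+ B₀) ℤ.≤ + lookup v i ℤ.+ z i
      untracked≥ {i} i∉ = subst (ℤ._≤ + lookup v i ℤ.+ z i)
        (≡-trans (lem (+ lookup w i) (+ B₀) (z i)) (cong (ℤ._+ + B₀) (sym (w′-eq i∉))))
        (ℤₚ.+-monoˡ-≤ (z i) (+≤+ (un i∉)))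
        where
        lem : ∀ a b c → (a ℤ.+ b) ℤ.+ c ≡ (a ℤ.+ c) ℤ.+ b
        lem = solve-∀
      apply : (∀ {i} → i ∈ˢ J → 0ℤ ℤ.≤ + val u i ℤ.+ z i) → ∃ λ v′ → Upd v z v′ ×
        (∀ {i} → i ∈ˢ J → + val u i ℤ.+ z i ℤ.≤ + lookup v′ i) ×
        (∀ {i} → i ∉ˢ J → lookup w′ i ℕ.+ B₀ ≤ lookup v′ i)
      apply ok with update v z enabled
        where
        enabled : ∀ i → 0ℤ ℤ.≤ + lookup v i ℤ.+ z i
        enabled i with i ∈? J
        ... | yes i∈ = ℤₚ.≤-trans (ok i∈) (ℤₚ.+-monoˡ-≤ (z i) (+≤+ (tr i∈)))
        ... | no i∉ = ℤₚ.≤-trans (+≤+ z≤n) (untracked≥ i∉)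
      ... | v′ , up′ = v′ , up′ ,
            (λ {i} i∈ → subst (+ val u i ℤ.+ z i ℤ.≤_) (sym (Upd.at up′ i))
              (ℤₚ.+-monoˡ-≤ (z i) (+≤+ (tr i∈)))) ,
            (λ {i} i∉ → ℤₚ.drop‿+≤+ (subst (+ (lookup w′ i ℕ.+ B₀) ℤ.≤_)
              (sym (Upd.at up′ i)) (untracked≥ i∉)))
      continue : ∀ {a} → Next q z u a → H.Final Sol.Inv (a , w′) ⊎ Lifted (a , w′) →
        ∃ λ v′ → Upd v z v′ × Target (q , v′)
      continue (won ok f) _ =
        let (v′ , up′ , tr′ , un′) = apply ok in
        v′ , up′ , inj₂ (attr-map (λ (fin , i) → fin , inj₁ i)
          (DropInv-closed (f tr′ λ i∉ → ℕₚ.≤-trans (ℕₚ.m≤n+m B₀ _) (un′ i∉))))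
      continue (lost _) (inj₁ (() , _))
      continue (lost _) (inj₂ ())
      continue (stay {u′} eq) x =
        let (v′ , up′ , tr′ , un′) = apply (λ {i} i∈ → subst (0ℤ ℤ.≤_) (eq i∈) (+≤+ z≤n))
            ab = above (λ {i} i∈ → ℤₚ.drop‿+≤+ (subst (ℤ._≤ + lookup v′ i) (sym (eq i∈)) (tr′ i∈))) un′
        in v′ , up′ , [ (λ (fin , i) → inj₁ (fin , inj₂ (u′ , w′ , i , ab))) ,
                            (λ p → inj₂ (p v′ ab)) ]′ x

    lift-attr : ∀ {c} → H.Attr arena (H.Final Sol.Inv) c → Lifted c
    lift-attr = H.attr-fold Lifted λ {q} → alg q
      where
      alg : ∀ a {w} → H.Forces (λ c → H.Final Sol.Inv c ⊎ Lifted c) w (arena a) → Lifted (a , w)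
      alg (inj₁ true) _ = tt
      alg (inj₁ false) (H.choose _ () _ _)
      alg (inj₁ false) (H.forced () _ _ _ _)
      alg (inj₂ (q , u)) (H.choose o m∈ up x) v ab with ∈-map⁻ (arena-move u) m∈
      ... | (q′ , z) , m∈′ , refl =
            let (v′ , up′ , t) = lift-move (proj₂ (next q′ z u)) ab up x in
            reach (choose o m∈′ up′ t)
      alg (inj₂ (q , u)) (H.forced o m∈ n up x) v ab with ∈-map⁻ (arena-move u) m∈
      ... | (q′ , z) , m∈′ , refl = reach (forced o m∈′
            (λ m h → proj₁ (answer m h))
            (λ m h → proj₁ (proj₂ (answer m h)))
            (λ m h → proj₂ (proj₂ (answer m h))))
        where
        answer : ∀ m → m ∈ proj₂ (G q) → ∃ λ v′ → Upd v (proj₂ m) v′ × Target (proj₁ m , v′)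
        answer (q′ , z) h =
          let h′ = ∈-map⁺ (arena-move u) h in
          lift-move (proj₂ (next q′ z u)) ab (up _ h′) (x _ h′)

    Inv-closed : Closed G Inv
    Inv-closed (inj₁ i) = attr-map (λ (f , i) → f , inj₁ i) (DropInv-closed i)
    Inv-closed (inj₂ (u , w , i , ab)) = lift-attr (Sol.closed i) _ ab

    -- No reserve appears here: an arena loss holds for every credit, in particular for the actual
    -- values of the untracked counters.
    record Same (u : Box) (w v : Vec ℕ d) : Set where
      constructor same
      field
        tracked   : ∀ {i} → i ∈ˢ J → lookup v i ≡ val u i
        untracked : ∀ {i} → i ∉ˢ J → lookup v i ≡ lookup w i

    Lost : H.Pos → Set₁
    Lost (inj₁ true , w) = Lift _ ⊥
    Lost (inj₁ false , w) = Lift _ ⊤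
    Lost (inj₂ (q , u) , w) = ∀ v → Same u w v → Lose G (q , v)

    module _ (Y : H.Pos → Set) where

      Yᴳ : Pos → Set
      Yᴳ (q , v) = ∃ λ u → ∃ λ w → Y (inj₂ (q , u) , w) × Same u w v

      lower-move : ∀ {q z u w v v′ a} → Next q z u a → Same u w v → Upd v z v′ →
        (∀ w′ → Upd w (mask z) w′ → Lost (a , w′) ⊎ (Fₛ a ≡ false × Y (a , w′))) →
        Lose G (q , v′) ⊎ (F q ≡ false × Yᴳ (q , v′))
      lower-move {q} {z} {u} {w} {v} {v′} nx (same tr un) up x =
        continue nx (x (proj₁ w′-upd) (proj₂ w′-upd))
        where
        w-eq : ∀ {i} → i ∉ˢ J → + lookup w i ℤ.+ mask z i ≡ + lookup v′ i
        w-eq {i} i∉ = ≡-trans (cong₂ (λ a b → + a ℤ.+ b) (sym (un i∉)) (mask-∉ z i∉)) (sym (Upd.at up i))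
        w′-upd : ∃ λ w′ → Upd w (mask z) w′
        w′-upd = update w (mask z) enabled
          where
          enabled : ∀ i → 0ℤ ℤ.≤ + lookup w i ℤ.+ mask z i
          enabled i with i ∈? J
          ... | yes i∈ = +≤+ z≤n
          ... | no i∉ = subst (0ℤ ℤ.≤_)
            (sym (≡-trans (cong (λ a → + a ℤ.+ z i) (sym (un i∉))) (sym (Upd.at up i)))) (+≤+ z≤n)
        v′-eq : ∀ {i} → i ∈ˢ J → + lookup v′ i ≡ + val u i ℤ.+ z i
        v′-eq {i} i∈ = ≡-trans (Upd.at up i) (cong (λ a → + a ℤ.+ z i) (tr i∈))
        continue : ∀ {a} → Next q z u a →
          Lost (a , proj₁ w′-upd) ⊎ (Fₛ a ≡ false × Y (a , proj₁ w′-upd)) →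
          Lose G (q , v′) ⊎ (F q ≡ false × Yᴳ (q , v′))
        continue (won _ _) (inj₁ (lift ()))
        continue (won _ _) (inj₂ (() , _))
        continue (lost l) _ = inj₁ (l v′-eq)
        continue (stay {u′} eq) x =
          [ (λ l → inj₁ (l v′ sm)) , (λ (f , y) → inj₂ (f , u′ , _ , y , sm)) ]′ x
          where
          sm : Same u′ (proj₁ w′-upd) v′
          sm = same (λ i∈ → ℤₚ.+-injective (≡-trans (v′-eq i∈) (sym (eq i∈))))
                    (λ {i} i∉ → ℤₚ.+-injective (≡-trans (sym (w-eq i∉)) (sym (Upd.at (proj₂ w′-upd) i))))

      lower-avoids : ∀ {q u w v} → Same u w v →
        H.Avoids (λ c → Lost c ⊎ (Fₛ (proj₁ c) ≡ false × Y c)) w (arena (inj₂ (q , u))) →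
        Avoids (λ c → Lose G c ⊎ (F (proj₁ c) ≡ false × Yᴳ c)) v (G q)
      lower-avoids {u = u} sm (H.all o f) = all o λ (q′ , z) m∈ v′ up →
        lower-move (proj₂ (next q′ z u)) sm up (f _ (∈-map⁺ (arena-move u) m∈))
      lower-avoids {u = u} sm (H.some o m∈ f) with ∈-map⁻ (arena-move u) m∈
      ... | (q′ , z) , m∈′ , refl = some o m∈′ λ v′ up → lower-move (proj₂ (next q′ z u)) sm up f
      lower-avoids {q} {u} sm (H.none o e) = none o (empty (proj₂ (G q)) e)
        where
        empty : ∀ ms → map (arena-move u) ms ≡ [] → ms ≡ []
        empty [] _ = refl

    lower-lose : ∀ {c} → H.Lose arena c → Lost c
    lower-lose = H.lose-fold Lost alg
      where
      alg : ∀ (Y : H.Pos → Set) →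
        (∀ {c′} → Y c′ → H.Avoids (λ c → Lost c ⊎ (Fₛ (proj₁ c) ≡ false × Y c))
                                 (proj₂ c′) (arena (proj₁ c′))) →
        ∀ {c} → Y c → Lost c
      -- The loop at the winning sink is enabled and final, so a trap could only continue into a
      -- smaller loss at this sink, which the fold has already excluded.
      alg Y st {inj₁ true , w} y with st y
      ... | H.all _ f with f _ (here refl) w (upd λ i → sym (ℤₚ.+-identityʳ _))
      ...   | inj₁ l = l
      ...   | inj₂ (() , _)
      alg Y st {inj₁ true , w} y | H.some () _ _
      alg Y st {inj₁ true , w} y | H.none () _
      alg Y st {inj₁ false , w} y = lift tt
      alg Y st {inj₂ (q , u) , w} y v sm =
        trap (Yᴳ Y) (u , w , y , sm) λ { (u , w , y , sm) → lower-avoids Y sm (st y) }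

    Decisionₛ : Vertex → Set₁
    Decisionₛ a = (∃ λ w → Sol.Inv (a , w)) ⊎ (∀ w → H.Lose arena (a , w))

    credit : ∀ {a} → Decisionₛ a → ℕ
    credit (inj₁ (w , _)) = proj₁ (bound (lookup w) (allFin d))
    credit (inj₂ _) = 0

    maxCredit : ∃ λ C → ∀ {a} → a ∈ states → credit (Sol.decision a) ≤ C
    maxCredit = bound (λ a → credit (Sol.decision a)) states

    C : ℕ
    C = proj₁ maxCredit

    cutoff : Cutoff J
    -- `C` covers the credit of every winnable arena vertex, and `B₀` is the reserve of `Above`.
    cutoff = record { Inv = Inv ; closed = Inv-closed ; B = C ℕ.+ B₀ ; decision = decide }
      where
      decide : ∀ c → Suffices J (C ℕ.+ B₀) Inv c ⊎ Hopeless J c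
      decide (q , v) with Finₚ.any? (λ i → (i ∈? J) ×-dec (B₀ ℕ.<? lookup v i))
      ... | yes (j , j∈ , big) = map₁
            (λ f v′ ge large → inj₁ (f v′ ge λ i∉ → ℕₚ.≤-trans (ℕₚ.m≤n+m B₀ C) (large i∉)))
            (drop-decision j∈ q v big)
      ... | no ¬big = inside (Sol.decision (inj₂ (q , u))) (proj₂ maxCredit (states-complete _))
        where
        u : Box
        u = box (lookup v)
        val-u : ∀ {i} → i ∈ˢ J → val u i ≡ lookup v i
        val-u {i} i∈ = val-box (lookup v) (ℕₚ.≮⇒≥ λ big → ¬big (i , i∈ , big))
        inside : (x : Decisionₛ (inj₂ (q , u))) → credit x ≤ C →
                 Suffices J (C ℕ.+ B₀) Inv (q , v) ⊎ Hopeless J (q , v)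
        inside (inj₁ (w , i)) ≤C = inj₁ λ v′ ge large → inj₂ (u , w , i , above
          (λ {j} j∈ → subst (_≤ lookup v′ j) (sym (val-u j∈)) (ge j∈))
          (λ {j} j∉ → ℕₚ.≤-trans (ℕₚ.+-monoˡ-≤ B₀
            (ℕₚ.≤-trans (proj₂ (bound (lookup w) (allFin d)) (∈-allFin j)) ≤C)) (large j∉)))
        inside (inj₂ l) _ = inj₂ λ v′ e → lower-lose (l v′) v′
          (same (λ j∈ → ≡-trans (e j∈) (sym (val-u j∈))) (λ _ → refl))

  cutoffs : ∀ J → Acc _<_ (Subset.∣ J ∣) → Cutoff J
  cutoffs J (acc rs) = Extend.cutoff J λ j j∈ → cutoffs (J ⊖ j) (rs (x∈p⇒∣p-x∣<∣p∣ j∈))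

  Winning : Pos → Set
  Winning = Cutoff.Inv (cutoffs Subset.⊤ (<-wellFounded _))

  winning-closed : Closed G Winning
  winning-closed = Cutoff.closed (cutoffs Subset.⊤ (<-wellFounded _))

  determined : ∀ c → Winning c ⊎ Lose G c
  determined c@(q , v) = Sum.map
    (λ f → f v (λ _ → ℕₚ.≤-refl) λ j∉ → ⊥-elim (j∉ ∈⊤)) (λ l → l v λ _ → refl)
    (Cutoff.decision (cutoffs Subset.⊤ (<-wellFounded _)) c)

-- Strategies of the VASS-MDP

upd-unique : ∀ {d} {v : Vec ℕ d} {z v′ v″} → Upd v z v′ → Upd v z v″ → v′ ≡ v″
upd-unique {v′ = v′} {v″} u u′ = ≡-trans (sym (tabulate∘lookup v′)) (≡-trans
  (tabulate-cong λ i → ℤₚ.+-injective (≡-trans (Upd.at u i) (sym (Upd.at u′ i)))) (tabulate∘lookup v″))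

seq : ∀ {A : Set} {k} → Vec A (suc k) → ℕ → A
seq (x ∷ _) zero = x
seq (x ∷ []) (suc _) = x
seq (_ ∷ y ∷ ys) (suc i) = seq (y ∷ ys) i

seq-tabulate : ∀ {A : Set} (g : ℕ → A) {k i} → i ≤ k → seq (tabulate {n = suc k} (g ∘ toℕ)) i ≡ g i
seq-tabulate g z≤n = refl
seq-tabulate g (s≤s p) = seq-tabulate (g ∘ suc) p

last-tabulate : ∀ {A : Set} (g : ℕ → A) k → last (tabulate {n = suc k} (g ∘ toℕ)) ≡ g k
last-tabulate g zero = refl
last-tabulate g (suc k) = last-tabulate (g ∘ suc) k

-- The predicate sees the membership proof because the successors in `forced` are indexed by it.
∃∈? : ∀ {A : Set} (xs : List A) (P : ∀ x → x ∈ xs → Set) → (∀ x x∈ → Dec (P x x∈)) →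
      Dec (∃ λ x → ∃ λ x∈ → P x x∈)
∃∈? [] P P? = no λ ()
∃∈? (x ∷ xs) P P? with P? x (here refl) | ∃∈? xs (λ y y∈ → P y (there y∈)) (λ y y∈ → P? y (there y∈))
... | yes p | _ = yes (x , here refl , p)
... | no _ | yes (y , y∈ , p) = yes (y , there y∈ , p)
... | no ¬p | no ¬q = no λ { (_ , here refl , p) → ¬p p ; (y , there y∈ , p) → ¬q (y , y∈ , p) }

-- Reachability of a state is repeated reachability once that state is made
-- absorbing; both problems are treated together, for absorbing states Absorbed.
module Extraction {d : ℕ} (S : VASSMDP d) (one : OneVASS S) (c₀ : Conf S)
                  (F : State S → Bool) (Absorbed : State S → Set)
                  (absorbed? : ∀ q → Dec (Absorbed q))
                  (absorbed⇒F : ∀ {q} → Absorbed q → F q ≡ true) where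

  open Energy {d} F

  Q : Set
  Q = State S

  _≟ᶜ_ : DecidableEquality (Conf S)
  _≟ᶜ_ = Productₚ.≡-dec Finₚ._≟_ (≡-dec ℕ._≟_)

  moves : Q → List Move
  moves q = map (λ t → tgt t , lookup (vec t)) (filter (λ t → src t Finₚ.≟ q) (trans S))

  real node : Game
  real q = owner S q , moves q
  node q with absorbed? q
  ... | yes _ = player1 , (q , λ _ → 0ℤ) ∷ []
  ... | no _ = real q

  node-real : ∀ {q} → ¬ Absorbed q → node q ≡ real q
  node-real {q} ¬a with absorbed? q
  ... | yes a = contradiction a ¬a
  ... | no _ = refl

  node-loop : ∀ {q} → Absorbed q → node q ≡ (player1 , (q , λ _ → 0ℤ) ∷ [])
  node-loop {q} a with absorbed? q
  ... | yes _ = refl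
  ... | no ¬a = contradiction a ¬a

  StepVia : Conf S → Conf S → Move → Set
  StepVia (_ , v) (q′ , v′) (q , z) = q ≡ q′ × Upd v z v′

  step⇒move : ∀ c c′ → Step S c c′ → ∃ λ m → m ∈ moves (proj₁ c) × StepVia c c′ m
  step⇒move (q , _) _ (t , t∈ , src≡ , tgt≡ , eq) =
    _ , ∈-map⁺ _ (∈-filter⁺ (λ t → src t Finₚ.≟ q) t∈ src≡) , tgt≡ , upd eq

  move⇒step : ∀ {q v v′ m} → m ∈ moves q → Upd v (proj₂ m) v′ → Step S (q , v) (proj₁ m , v′)
  move⇒step {q} m∈ u with ∈-map⁻ _ m∈
  ... | t , t∈ , refl =
        let (t∈′ , src≡) = ∈-filter⁻ (λ t → src t Finₚ.≟ q) {xs = trans S} t∈ in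
        t , t∈′ , src≡ , refl , Upd.at u

  -- Here the 1-VASS condition enters: the move picked by a losing certificate can really be played,
  -- and it leaves the counters unchanged.
  prob-zero : ∀ {q m} → owner S q ≡ prob → m ∈ moves q → ∀ v → Upd v (proj₂ m) v
  prob-zero {q} o m∈ v with ∈-map⁻ _ m∈
  ... | t , t∈ , refl = upd λ i → sym (≡-trans
          (cong (λ z → + lookup v i ℤ.+ lookup z i)
            (one t t∈′ (≡-trans (cong (owner S) src≡) o)))
          (≡-trans (cong (ℤ._+_ (+ lookup v i)) (lookup-replicate i (+ 0))) (ℤₚ.+-identityʳ _)))
    where
    t∈′ = proj₁ (∈-filter⁻ (λ t → src t Finₚ.≟ q) {xs = trans S} t∈)
    src≡ = proj₂ (∈-filter⁻ (λ t → src t Finₚ.≟ q) {xs = trans S} t∈)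

  successor? : ∀ c → (∃ λ c′ → Step S c c′) ⊎ Deadlock S c
  successor? (q , v) with any? (λ m → Finₚ.all? λ i → 0ℤ ℤ.≤? + lookup v i ℤ.+ proj₂ m i) (moves q)
  ... | yes p = let (m , m∈ , 0≤) = find p ; (v′ , u) = update v (proj₂ m) 0≤ in
        inj₁ ((proj₁ m , v′) , move⇒step m∈ u)
  ... | no ¬p = inj₂ λ (c′ , st) → let (m , m∈ , _ , u) = step⇒move (q , v) c′ st in
        ¬p (lose m∈ λ i → subst (0ℤ ℤ.≤_) (Upd.at u i) (+≤+ z≤n))

  prefix-cong : ∀ {f g : ℕ → Conf S} n → (∀ j → j ≤ n → f j ≡ g j) → prefix S f n ≡ prefix S g n
  prefix-cong n e = tabulate-cong λ j → e (toℕ j) (ℕₚ.≤-pred (Finₚ.toℕ<n j))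

  -- A strategy of Player 1 from an invariant

  module Winning (Inv : Pos → Set) (closed : Closed node Inv) (i₀ : Inv c₀) where

    Tree : Pos → Set
    Tree = Attr node (Final Inv)

    -- What remains of the current attractor tree, with the position it belongs to. It is recomputed
    -- from the history, which need not be consistent with the strategy, so the position may differ
    -- from the actual one.
    Memory : Set
    Memory = ∃ Tree

    resume : ∀ {c} → Final Inv c ⊎ Tree c → Tree c
    resume (inj₁ (_ , i)) = closed i
    resume (inj₂ t) = t

    Answer : (ms : List Move) → (∀ m → m ∈ ms → Vec ℕ d) → Conf S → Set
    Answer ms n c = ∃ λ m → ∃ λ m∈ → (proj₁ m , n m m∈) ≡ c

    answer? : ∀ ms n c → Dec (Answer ms n c)
    answer? ms n c = ∃∈? ms _ λ m m∈ → _ ≟ᶜ c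

    child : Memory → Conf S → ∃ λ c → Final Inv c ⊎ Tree c
    child (_ , reach (choose _ _ _ x)) _ = _ , x
    child (c , t@(reach (forced _ _ n _ x))) c′ with answer? (proj₂ (node (proj₁ c))) n c′
    ... | yes (m , m∈ , _) = _ , x m m∈
    -- A default value; `answered` excludes this case for real steps before absorption.
    ... | no _ = c , inj₂ t

    advance : Memory → Conf S → Memory
    advance s c = let (c′ , x) = child s c in c′ , resume x

    track : (ℕ → Conf S) → ℕ → Memory
    track f zero = c₀ , closed i₀
    track f (suc i) = advance (track f i) (f (suc i))

    track-cong : ∀ {f g} k → (∀ i → i ≤ k → f i ≡ g i) → track f k ≡ track g k
    track-cong zero e = refl
    track-cong (suc k) e = cong₂ advance
      (track-cong k λ i i≤k → e i (ℕₚ.≤-trans i≤k (ℕₚ.n≤1+n k))) (e (suc k) ℕₚ.≤-refl)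

    fallback : Conf S → Conf S
    fallback c with successor? c
    ... | inj₁ (c′ , _) = c′
    ... | inj₂ _ = c

    fallback-step : ∀ c → ¬ Deadlock S c → Step S c (fallback c)
    fallback-step c ¬dead with successor? c
    ... | inj₁ (_ , st) = st
    ... | inj₂ dead = contradiction dead ¬dead

    select : ∀ {A B : Set} → Dec A → Dec B → Conf S → Conf S → Conf S
    select (yes _) (no _) c _ = c
    select _ _ _ c = c

    select-first : ∀ {A B : Set} (a? : Dec A) (b? : Dec B) {c c′} → A → ¬ B → select a? b? c c′ ≡ c
    select-first (yes _) (no _) _ _ = refl
    select-first (no ¬a) _ a _ = contradiction a ¬a
    select-first (yes _) (yes b) _ ¬b = contradiction b ¬b

    -- The fallback keeps the strategy legal on inconsistent histories and after absorption, where
    -- the tree only prescribes the artificial loop.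
    response : Memory → Conf S → Conf S
    response (_ , reach (forced _ _ _ _ _)) c = fallback c
    response (c , reach (choose {m} {v′} _ _ _ _)) c′ =
      select (c ≟ᶜ c′) (absorbed? (proj₁ c)) (proj₁ m , v′) (fallback c′)

    response-step : ∀ s c → ¬ Deadlock S c → Step S c (response s c)
    response-step (_ , reach (forced _ _ _ _ _)) c ¬dead = fallback-step c ¬dead
    response-step (c , reach (choose _ m∈ u _)) c′ ¬dead with c ≟ᶜ c′ | absorbed? (proj₁ c)
    ... | yes refl | no ¬a = move⇒step m∈ u
    ... | yes _ | yes _ = fallback-step c′ ¬dead
    ... | no _ | yes _ = fallback-step c′ ¬dead
    ... | no _ | no _ = fallback-step c′ ¬dead

    σ : Strategy S
    σ {k} cs = response (track (seq cs) k) (last cs)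

    σ-strategy : IsStrategy S σ
    σ-strategy {k} cs _ _ ¬dead = response-step (track (seq cs) k) (last cs) ¬dead

    σ-prefix : ∀ ρ i → σ (prefix S ρ i) ≡ response (track ρ i) (ρ i)
    σ-prefix ρ i = cong₂ response (track-cong i λ j j≤i → seq-tabulate ρ j≤i) (last-tabulate ρ i)

    answered : ∀ {c c′ n} → ¬ Absorbed (proj₁ c) →
      (∀ m m∈ → Upd (proj₂ c) (proj₂ m) (n m m∈)) → Step S c c′ →
      Answer (proj₂ (node (proj₁ c))) n c′
    answered {c} {c′} ¬a up st with step⇒move c c′ st
    ... | m , m∈ , refl , u =
          let m∈′ = subst (λ N → m ∈ proj₂ N) (sym (node-real ¬a)) m∈ in
          m , m∈′ , cong (proj₁ m ,_) (upd-unique (up m m∈′) u)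

    advance-sound : ∀ s {c′} → ¬ Absorbed (proj₁ (proj₁ s)) → Step S (proj₁ s) c′ →
      (IsP1 S (proj₁ s) → c′ ≡ response s (proj₁ s)) → proj₁ (advance s c′) ≡ c′
    advance-sound (c , reach (choose o _ _ _)) ¬a st follows =
      sym (≡-trans (follows (≡-trans (cong proj₁ (sym (node-real ¬a))) o))
                  (select-first (c ≟ᶜ c) (absorbed? (proj₁ c)) refl ¬a))
    advance-sound (c , reach (forced _ _ n up _)) {c′} ¬a st _
      with answer? (proj₂ (node (proj₁ c))) n c′
    ... | yes (_ , _ , e) = e
    ... | no unanswered = contradiction (answered ¬a up st) unanswered

    module _ (ρ : ℕ → Conf S) (start : ρ 0 ≡ c₀) where

      Unabsorbed : ℕ → Set
      Unabsorbed i = ∀ j → j < i → ¬ Absorbed (proj₁ (ρ j))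

      track-sound : ∀ i → (∀ j → j < i → StepOK S σ ρ j) → Unabsorbed i → proj₁ (track ρ i) ≡ ρ i
      track-sound zero _ _ = sym start
      track-sound (suc i) ok ¬a
        with track ρ i | track-sound i (λ j j<i → ok j (ℕₚ.m<n⇒m<1+n j<i))
                                           (λ j j<i → ¬a j (ℕₚ.m<n⇒m<1+n j<i))
           | σ-prefix ρ i
      ... | s | refl | e = advance-sound s (¬a i ℕₚ.≤-refl) (proj₁ (ok i ℕₚ.≤-refl))
            λ p1 → ≡-trans (proj₂ (ok i ℕₚ.≤-refl) p1) e

      unabsorbed? : ∀ i → (∃ λ j → j < i × Absorbed (proj₁ (ρ j))) ⊎ Unabsorbed i
      unabsorbed? zero = inj₂ λ _ ()
      unabsorbed? (suc i) with unabsorbed? i | absorbed? (proj₁ (ρ i))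
      ... | inj₁ (j , j<i , a) | _ = inj₁ (j , ℕₚ.m<n⇒m<1+n j<i , a)
      ... | inj₂ _ | yes a = inj₁ (i , ℕₚ.≤-refl , a)
      ... | inj₂ ¬a | no ¬aᵢ = inj₂ λ j j<1+i → case ℕₚ.m<1+n⇒m<n∨m≡n j<1+i of λ
            { (inj₁ j<i) → ¬a j j<i ; (inj₂ refl) → ¬aᵢ }

      module _ (ok : ∀ i → StepOK S σ ρ i) where

        Goal : ℕ → Set
        Goal i = (∃ λ j → Absorbed (proj₁ (ρ j))) ⊎ (∃ λ j → i ≤ j × F (proj₁ (ρ j)) ≡ true)

        later-goal : ∀ {i} → Goal (suc i) → Goal i
        later-goal = map₂ λ (j , i<j , f) → j , ℕₚ.<⇒≤ i<j , f

        -- Recursion on the tree and not on time: each step of the play descends in it, so a final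
        -- vertex comes after finitely many steps unless the play is absorbed.
        progress : ∀ {c} (t : Tree c) i → track ρ i ≡ (c , t) → Unabsorbed i → Goal i
        arrive : ∀ {c} (x : Final Inv c ⊎ Tree c) i → track ρ i ≡ (c , resume x) → Unabsorbed i → Goal i

        arrive (inj₂ t) i e ¬a = progress t i e ¬a
        arrive (inj₁ (f , _)) i e ¬a = inj₂ (i , ℕₚ.≤-refl , subst (λ c → F (proj₁ c) ≡ true)
          (≡-trans (cong proj₁ (sym e)) (track-sound i (λ j _ → ok j) ¬a)) f)

        progress t i e ¬a with unabsorbed? (suc i)
        ... | inj₁ (j , _ , a) = inj₁ (j , a)
        progress (reach (choose _ _ _ x)) i e _ | inj₂ ¬a =
          later-goal (arrive x (suc i) (cong (λ s → advance s (ρ (suc i))) e) ¬a)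
        progress {c} (reach (forced _ _ n up x)) i e ¬aᵢ | inj₂ ¬a
          with answer? (proj₂ (node (proj₁ c))) n (ρ (suc i)) | cong (λ s → advance s (ρ (suc i))) e
        ... | yes (m , m∈ , _) | e′ = later-goal (arrive (x m m∈) (suc i) e′ ¬a)
        ... | no unanswered | _ = contradiction
              (answered (subst (λ c → ¬ Absorbed (proj₁ c)) (sym here≡) (¬a i ℕₚ.≤-refl)) up
                (subst (λ c → Step S c (ρ (suc i))) (sym here≡) (proj₁ (ok i))))
              unanswered
          where
          here≡ : c ≡ ρ i
          here≡ = ≡-trans (cong proj₁ (sym e)) (track-sound i (λ j _ → ok j) ¬aᵢ)

        infinite : ∀ i → Goal i
        infinite i with unabsorbed? i
        ... | inj₁ (j , _ , a) = inj₁ (j , a)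
        ... | inj₂ ¬a = progress (proj₂ (track ρ i)) i refl ¬a

      finite : ∀ k → (∀ i → i < k → StepOK S σ ρ i) → Deadlock S (ρ k) →
               ∃ λ j → j ≤ k × Absorbed (proj₁ (ρ j))
      finite k ok dead with unabsorbed? (suc k)
      ... | inj₁ (j , s≤s j≤k , a) = j , j≤k , a
      ... | inj₂ ¬a
        with track ρ k | track-sound k ok (λ j j<k → ¬a j (ℕₚ.m<n⇒m<1+n j<k))
      ...   | c , t | refl = contradiction (alive t) dead
        where
        in-real : ∀ {m} → m ∈ proj₂ (node (proj₁ (ρ k))) → m ∈ moves (proj₁ (ρ k))
        in-real = subst (λ N → _ ∈ proj₂ N) (node-real (¬a k ℕₚ.≤-refl))
        alive : Tree (ρ k) → ∃ λ c′ → Step S (ρ k) c′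
        alive (reach (choose {m} {v′} _ m∈ u _)) = (proj₁ m , v′) , move⇒step (in-real m∈) u
        -- The witness `m₀` of `forced` provides the successor.
        alive (reach (forced {m} _ m∈ n u _)) = (proj₁ m , n m m∈) , move⇒step (in-real m∈) (u _ m∈)

  -- Refuting a strategy by a losing certificate

  module Losing (σ : Strategy S) (isσ : IsStrategy S σ)
    (infinite : ∀ ρ → InfOutcome S c₀ σ ρ → (∀ i → ¬ Absorbed (proj₁ (ρ i))) →
                ∀ n → (∀ i → n < i → F (proj₁ (ρ i)) ≡ false) → ⊥)
    (finite : ∀ k ρ → FinOutcome S c₀ σ k ρ → (∀ i → i ≤ k → ¬ Absorbed (proj₁ (ρ i))) → ⊥) where

    rejecting⇒¬absorbed : ∀ {q} → F q ≡ false → ¬ Absorbed q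
    rejecting⇒¬absorbed f a with ≡-trans (sym f) (absorbed⇒F a)
    ... | ()

    record History (f : ℕ → Conf S) (n : ℕ) : Set where
      field
        start      : f 0 ≡ c₀
        steps      : ∀ i → i < n → StepOK S σ f i
        unabsorbed : ∀ i → i ≤ n → ¬ Absorbed (proj₁ (f i))
    open History

    _▷_at_ : (ℕ → Conf S) → Conf S → ℕ → ℕ → Conf S
    (f ▷ c at n) m with m ℕ.≤? n
    ... | yes _ = f m
    ... | no _ = c

    ▷-old : ∀ f c {n m} → m ≤ n → (f ▷ c at n) m ≡ f m
    ▷-old f c {n} {m} m≤n with m ℕ.≤? n
    ... | yes _ = refl
    ... | no m≰n = contradiction m≤n m≰n

    ▷-new : ∀ f c n → (f ▷ c at n) (suc n) ≡ c
    ▷-new f c n with suc n ℕ.≤? n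
    ... | yes 1+n≤n = contradiction 1+n≤n ℕₚ.1+n≰n
    ... | no _ = refl

    stepOK-cong : ∀ {f g} i → (∀ j → j ≤ suc i → f j ≡ g j) → StepOK S σ f i → StepOK S σ g i
    stepOK-cong {f} {g} i e (st , follows) =
      subst₂ (Step S) eᵢ eₛ st ,
      λ p1 → ≡-trans (sym eₛ) (≡-trans (follows (subst (IsP1 S) (sym eᵢ) p1))
        (cong σ (prefix-cong i λ j j≤i → e j (ℕₚ.≤-trans j≤i (ℕₚ.n≤1+n i)))))
      where
      eᵢ = e i (ℕₚ.n≤1+n i)
      eₛ = e (suc i) ℕₚ.≤-refl

    Continues : (ℕ → Conf S) → ℕ → Conf S → Set
    Continues f n c = Step S (f n) c × (IsP1 S (f n) → c ≡ σ (prefix S f n))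

    extend : ∀ {f n c} → History f n → Continues f n c → ¬ Absorbed (proj₁ c) →
             History (f ▷ c at n) (suc n)
    extend {f} {n} {c} h (st , follows) ¬a = record
      { start = ≡-trans (▷-old f c {n} z≤n) (start h)
      ; steps = λ i i<1+n → case ℕₚ.m<1+n⇒m<n∨m≡n i<1+n of λ
          { (inj₁ i<n) → stepOK-cong i
              (λ j j≤1+i → sym (▷-old f c (ℕₚ.≤-trans j≤1+i i<n))) (steps h i i<n)
          ; (inj₂ refl) → subst₂ (Step S) (sym (▷-old f c ℕₚ.≤-refl)) (sym (▷-new f c n)) st ,
              λ p1 → ≡-trans (▷-new f c n) (≡-trans (follows (subst (IsP1 S) (▷-old f c ℕₚ.≤-refl) p1))
                (cong σ (prefix-cong n λ j j≤n → sym (▷-old f c j≤n)))) }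
      ; unabsorbed = λ i i≤1+n → case ℕₚ.m≤n⇒m<n∨m≡n i≤1+n of λ
          { (inj₁ (s≤s i≤n)) →
              subst (λ c → ¬ Absorbed (proj₁ c)) (sym (▷-old f c i≤n)) (unabsorbed h i i≤n)
          ; (inj₂ refl) → subst (λ c → ¬ Absorbed (proj₁ c)) (sym (▷-new f c n)) ¬a }
      }

    history-play : ∀ {f n} → History f n → IsPlay S (prefix S f n)
    history-play {f} {n} h i = subst₂ (Step S)
      (≡-trans (cong f (sym (Finₚ.toℕ-inject₁ i))) (sym (lookup∘tabulate (f ∘ toℕ) (inject₁ i))))
      (sym (lookup∘tabulate (f ∘ toℕ) (suc i)))
      (proj₁ (steps h (toℕ i) (Finₚ.toℕ<n i)))

    -- All histories ending in `c` are covered, since `σ` may depend on the past and the certificate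
    -- does not.
    Refuted : Pos → Set
    Refuted c = ¬ Absorbed (proj₁ c) × (∀ f n → f n ≡ c → History f n → ⊥)

    module _ (Y : Pos → Set)
             (st : ∀ {c} → Y c → Avoids (λ c → Refuted c ⊎ (F (proj₁ c) ≡ false × Y c))
                                        (proj₂ c) (node (proj₁ c))) where

      -- An absorbed vertex loops and is final, so the loop cannot stay in the trap outside `F`; nor
      -- can it enter a refuted position, which is unabsorbed.
      y-unabsorbed : ∀ {c} → Y c → ¬ Absorbed (proj₁ c)
      y-unabsorbed {q , v} y a with subst (Avoids _ v) (node-loop a) (st y)
      ... | all _ f = [ (λ (¬a , _) → ¬a a) , (λ (f , _) → rejecting⇒¬absorbed f a) ]′
                        (f _ (here refl) v (upd λ _ → sym (ℤₚ.+-identityʳ _)))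
      ... | some () _ _
      ... | none () _

      -- A deadlock contradicts `finite`, and moving on to a smaller certificate contradicts the
      -- induction hypothesis for the extended history. What is left is a step inside the trap that
      -- avoids `F`.
      continue : ∀ {f n} → History f n → Y (f n) →
                 ∃ λ c → Continues f n c × F (proj₁ c) ≡ false × Y c
      continue {f} {n} h y
        with subst (Avoids _ (proj₂ (f n))) (node-real (y-unabsorbed y)) (st y)
      ... | none _ empty = ⊥-elim (finite n f (start h , steps h , dead) (unabsorbed h))
        where
        dead : Deadlock S (f n)
        dead (c′ , s) = let (m , m∈ , _) = step⇒move (f n) c′ s in case subst (m ∈_) empty m∈ of λ ()
      ... | some {m} o m∈ g = next (g _ zero-upd)
        where
        zero-upd = prob-zero o m∈ (proj₂ (f n))
        continues : Continues f n (proj₁ m , proj₂ (f n))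
        continues = move⇒step m∈ zero-upd , λ p1 → case ≡-trans (sym o) p1 of λ ()
        next : _ → ∃ λ c → Continues f n c × F (proj₁ c) ≡ false × Y c
        next (inj₂ (fl , y)) = _ , continues , fl , y
        next (inj₁ (¬a , refute)) =
          ⊥-elim (refute _ (suc n) (▷-new f _ n) (extend h continues ¬a))
      ... | all o g with successor? (f n)
      ...   | inj₂ dead = ⊥-elim (finite n f (start h , steps h , dead) (unabsorbed h))
      ...   | inj₁ succ = next (g _ (proj₁ (proj₂ via)) _ (proj₂ (proj₂ (proj₂ via))))
        where
        c = σ (prefix S f n)
        step : Step S (f n) c
        step = subst (λ c′ → Step S c′ c) (last-tabulate f n)
          (isσ (prefix S f n) (history-play h)
            (subst (IsP1 S) (sym (last-tabulate f n)) o)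
            (subst (λ c → ¬ Deadlock S c) (sym (last-tabulate f n)) λ dead → dead succ))
        via = step⇒move (f n) c step
        continues : Continues f n c
        continues = step , λ _ → refl
        next : Refuted (proj₁ (proj₁ via) , proj₂ c) ⊎
                 (F (proj₁ (proj₁ via)) ≡ false × Y (proj₁ (proj₁ via) , proj₂ c)) →
               ∃ λ c → Continues f n c × F (proj₁ c) ≡ false × Y c
        next x with subst (λ q → Refuted (q , proj₂ c) ⊎ (F q ≡ false × Y (q , proj₂ c)))
                          (proj₁ (proj₂ (proj₂ via))) x
        ... | inj₂ (fl , y) = c , continues , fl , y
        ... | inj₁ (¬a , refute) = ⊥-elim (refute _ (suc n) (▷-new f c n) (extend h continues ¬a))

      module _ {f₀ n₀} (h₀ : History f₀ n₀) (y₀ : Y (f₀ n₀)) where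

        record Run (k : ℕ) : Set where
          field
            f       : ℕ → Conf S
            history : History f (k ℕ.+ n₀)
            inside  : Y (f (k ℕ.+ n₀))
            avoids  : ∀ i → n₀ < i → i ≤ k ℕ.+ n₀ → F (proj₁ (f i)) ≡ false
        open Run

        grow : ∀ {k} (r : Run k) → ∃ λ (r′ : Run (suc k)) → ∀ i → i ≤ k ℕ.+ n₀ → f r′ i ≡ f r i
        grow {k} r = record
          { f = f r ▷ c at (k ℕ.+ n₀)
          ; history = extend (history r) cont (y-unabsorbed y)
          ; inside = subst Y (sym (▷-new (f r) c (k ℕ.+ n₀))) y
          ; avoids = λ i n₀<i i≤ → case ℕₚ.m≤n⇒m<n∨m≡n i≤ of λ
              { (inj₁ (s≤s i≤n)) →
                  subst (λ c → F (proj₁ c) ≡ false) (sym (▷-old (f r) c i≤n)) (avoids r i n₀<i i≤n)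
              ; (inj₂ refl) → subst (λ c → F (proj₁ c) ≡ false) (sym (▷-new (f r) c (k ℕ.+ n₀))) fl }
          } , λ i → ▷-old (f r) c
          where
          next = continue (history r) (inside r)
          c = proj₁ next
          cont = proj₁ (proj₂ next)
          fl = proj₁ (proj₂ (proj₂ next))
          y = proj₂ (proj₂ (proj₂ next))

        run : ∀ k → Run k
        run zero = record { f = f₀ ; history = h₀ ; inside = y₀
                          ; avoids = λ i n₀<i i≤n₀ → contradiction i≤n₀ (ℕₚ.<⇒≱ n₀<i) }
        run (suc k) = proj₁ (grow (run k))

        -- The diagonal limit of the growing runs: `run i` reaches at least time `i`, and later runs
        -- agree with it there.
        ρ : ℕ → Conf S
        ρ i = f (run i) i

        run-agrees : ∀ j i → i ≤ j → f (run j) i ≡ ρ i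
        run-agrees zero zero _ = refl
        run-agrees (suc j) i i≤1+j with ℕₚ.m≤n⇒m<n∨m≡n i≤1+j
        ... | inj₂ refl = refl
        ... | inj₁ (s≤s i≤j) = ≡-trans
              (proj₂ (grow (run j)) i (ℕₚ.≤-trans i≤j (ℕₚ.m≤m+n j n₀))) (run-agrees j i i≤j)

        impossible : ⊥
        impossible = infinite ρ
          (start h₀ , λ i → stepOK-cong i (λ j j≤1+i → run-agrees (suc i) j j≤1+i)
            (steps (history (run (suc i))) i (ℕₚ.m≤m+n (suc i) n₀)))
          (λ i → unabsorbed (history (run i)) i (ℕₚ.m≤m+n i n₀))
          n₀ (λ i n₀<i → avoids (run i) i n₀<i (ℕₚ.m≤m+n i n₀))

    refuted : ∀ {c} → Lose node c → Refuted c
    refuted = lose-fold Refuted λ Y st {c} y →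
      y-unabsorbed Y st y , λ { f n refl h → impossible Y st h y }

    not-lost : ¬ Lose node c₀
    not-lost l = let (¬a , refute) = refuted l in refute (λ _ → c₀) 0 refl record
      { start = refl ; steps = λ _ () ; unabsorbed = λ { _ z≤n → ¬a } }

module Decide {d : ℕ} (S : VASSMDP d) (one : OneVASS S) (c₀ : Conf S) (qF : State S) where

  F : State S → Bool
  F q = does (q Finₚ.≟ qF)

  F⇒≡ : ∀ {q} → F q ≡ true → q ≡ qF
  F⇒≡ {q} f with q Finₚ.≟ qF
  ... | yes e = e

  ≡⇒F : ∀ {q} → q ≡ qF → F q ≡ true
  ≡⇒F {q} = dec-true (q Finₚ.≟ qF)

  ≢F : ∀ {q} → F q ≡ false → q ≢ qF
  ≢F f e = case ≡-trans (sym f) (≡⇒F e) of λ ()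

  sureReach? : Dec (SureReach S c₀ qF)
  sureReach? = [ yes ∘ win , no ∘ refute ]′ (determined c₀)
    where
    open Extraction S one c₀ F (_≡ qF) (Finₚ._≟ qF) ≡⇒F
    open KnownCredit F Finₚ._≟_ (allFin _) ∈-allFin node
    win : Winning c₀ → SureReach S c₀ qF
    win i₀ = σ , (λ {k} → σ-strategy {k}) ,
      (λ ρ (start , ok) → [ (λ (j , a) → j , a) , (λ (j , _ , f) → j , F⇒≡ f) ]′
        (infinite ρ start ok 0)) ,
      (λ k ρ (start , ok , dead) → finite ρ start k ok dead)
      where open Extraction.Winning S one c₀ F (_≡ qF) (Finₚ._≟ qF) ≡⇒F Winning winning-closed i₀
    refute : Energy.Lose F node c₀ → ¬ SureReach S c₀ qF
    refute l (σ , isσ , inf , fin) = Losing.not-lost σ (λ {k} → isσ {k})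
      (λ ρ out ¬a _ _ → let (i , e) = inf ρ out in ¬a i e)
      (λ k ρ out ¬a → let (i , i≤k , e) = fin k ρ out in ¬a i i≤k e) l

  sureRepReach? : Dec (SureRepReach S c₀ qF)
  sureRepReach? = [ yes ∘ win , no ∘ refute ]′ (determined c₀)
    where
    open Extraction S one c₀ F (λ _ → ⊥) (λ _ → no λ ()) ⊥-elim
    open KnownCredit F Finₚ._≟_ (allFin _) ∈-allFin node
    win : Winning c₀ → SureRepReach S c₀ qF
    win i₀ = σ , (λ {k} → σ-strategy {k}) ,
      (λ ρ (start , ok) m → [ (λ ()) , (λ (j , m≤j , f) → j , m≤j , F⇒≡ f) ]′ (infinite ρ start ok m)) ,
      (λ k ρ (start , ok , dead) → proj₂ (proj₂ (finite ρ start k ok dead)))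
      where open Extraction.Winning S one c₀ F (λ _ → ⊥) (λ _ → no λ ()) ⊥-elim Winning winning-closed i₀
    refute : Energy.Lose F node c₀ → ¬ SureRepReach S c₀ qF
    refute l (σ , isσ , inf , fin) = Losing.not-lost σ (λ {k} → isσ {k})
      -- The position at time `n`, where the play enters the trap for good, may itself be final, so
      -- the contradicting visit is sought from `suc n` on.
      (λ ρ out _ n avoid → let (i , n<i , e) = inf ρ out (suc n) in ≢F (avoid i n<i) e)
      (λ k ρ out _ → fin k ρ out) l

theorem6 : (∀ {d : ℕ} (S : VASSMDP d) → OneVASS S → (c₀ : Conf S) (qF : State S) → Dec (SureReach S c₀ qF))
    × (∀ {d : ℕ} (S : VASSMDP d) → OneVASS S → (c₀ : Conf S) (qF : State S) → Dec (SureRepReach S c₀ qF))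
theorem6 = Decide.sureReach? , Decide.sureRepReach?
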